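{- Let $n$ be a positive integer and let $$\varphi(x)=\frac{1}{n}\sum_{\pi\in\mathfrak{S}_n}\binom{x+n-1-\operatorname{cdes}(\pi)}{n-1}\,\pi$$ be the cyclic structure polynomial, a polynomial in $x$ with coefficients in the group algebra $\mathbb{Q}[\mathfrak{S}_n]$ of the symmetric group. Then, as polynomials in $x$ and $y$ with coefficients in $\mathbb{Q}[\mathfrak{S}_n]$, $$\varphi(x)\varphi(y)=\varphi(xy).$$
   Context: $\mathfrak{S}_n$ is the symmetric group, viewed as the group of bijections $\pi:[n]\to[n]$ with $[n]=\{1,2,\ldots,n\}$; the product is composition of functions, $(\sigma\tau)(s)=\sigma(\tau(s))$. A permutation $\pi\in\mathfrak{S}_n$ has a cyclic descent at position $i\in\{1,\ldots,n\}$ if $1\le i\le n-1$ and $\pi(i)>\pi(i+1)$, or if $i=n$ and $\pi(n)>\pi(1)$. The cyclic descent number $\operatorname{cdes}(\pi)$ is the number of cyclic descents of $\pi$. For a polynomial $p$ and an integer $m\ge 0$, $\binom{p}{m}=\frac{p(p-1)\cdots(p-m+1)}{m!}$. The variables $x,y$ are commuting indeterminates that also commute with the elements of the group algebra. -}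

module Defs where

open import Algebra.Bundles using (Group)
open import Algebra.Bundles.Raw using (RawMonoid; RawRing)
open import Algebra.Construct.DirectProduct using () renaming (rawMonoid to _×ᴹ_)
open import Algebra.Definitions.RawSemiring using () renaming (_^_ to power)
open import Data.Bool.Base using (if_then_else_)
open import Data.Fin.Base using (Fin; zero; suc; toℕ; punchIn) renaming (_>_ to _>ᶠ_)
open import Data.Fin.Permutation using
  (Permutation′; _≈_; _⟨$⟩ʳ_; _⟨$⟩ˡ_; id; flip; _∘ₚ_; insert; remove;
   inverseˡ; inverseʳ; insert-remove; insert-punchIn)
open import Data.Fin.Properties using (all?; punchIn-injective)
  renaming (_≟_ to _≟ᶠ_; _<?_ to _<?ᶠ_)
import Data.Integer.Base as ℤ
open import Data.List.Base using
  (List; []; _∷_; [_]; _++_; map; foldr; filter; length; allFin; cartesianProductWith)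
import Data.List.Membership.Setoid as Membership
import Data.List.Membership.Setoid.Properties as Membershipₚ
open import Data.List.Membership.Propositional.Properties using (∈-allFin)
import Data.List.Relation.Unary.All as All
import Data.List.Relation.Unary.AllPairs as AllPairs
open import Data.List.Relation.Unary.Any using (here)
import Data.List.Relation.Unary.Unique.Setoid as Unique
import Data.List.Relation.Unary.Unique.Setoid.Properties as Uniqueₚ
open import Data.List.Relation.Unary.Unique.Propositional.Properties using (allFin⁺)
open import Data.Nat.Base using (ℕ; zero; suc; pred; NonZero; _!; +-0-rawMonoid)
open import Data.Nat.DivMod using (_mod_)
open import Data.Nat.Properties using (_!≢0) renaming (_≟_ to _≟ℕ_)
open import Data.Product.Base using (_×_; _,_)
open import Data.Product.Relation.Binary.Pointwise.NonDependent using (×-decidable)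
open import Data.Rational.Base using (ℚ; _/_) renaming (+-*-rawRing to ℚ-rawRing)
open import Level using (Level; 0ℓ; _⊔_)
open import Relation.Binary.Bundles using (Setoid)
open import Relation.Binary.Definitions using (Decidable)
open import Relation.Binary.PropositionalEquality.Core
  using (_≡_; refl; sym; trans; cong)
open import Relation.Binary.PropositionalEquality.Properties using (setoid)
open import Relation.Nullary.Decidable using (does)
import Relation.Unary as Unary
open Unary using (Pred)

-- K[M], for a monoid M with decidable equality. An element is a finite formal
-- sum Σ aᵢ·mᵢ, given by the list of its terms (aᵢ , mᵢ). Repeated mᵢ and zero
-- aᵢ are allowed: the equality of K[M] is equality of all coefficients.
--
-- Taking M = (ℕ , +) gives the polynomials in one indeterminate, M = ℕ × ℕ
-- those in two. The indeterminates commute with each other and with K, since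
-- (a·m)(b·m′) = ab·(m ∙ m′) also for noncommutative K.

module MonoidAlgebra {a ℓ b ℓ′ : Level} (K : RawRing a ℓ) (M : RawMonoid b ℓ′)
  (_≟_ : Decidable (RawMonoid._≈_ M)) where

  private
    module K = RawRing K
    module M = RawMonoid M

  Elem : Set (a ⊔ b)
  Elem = List (K.Carrier × M.Carrier)

  coeff : Elem → M.Carrier → K.Carrier
  coeff []            m = K.0#
  coeff ((c , k) ∷ f) m = (if does (k ≟ m) then c else K.0#) K.+ coeff f m

  _≋_ : Elem → Elem → Set (b ⊔ ℓ)
  f ≋ g = ∀ m → coeff f m K.≈ coeff g m

  term : K.Carrier → M.Carrier → Elem
  term c m = [ (c , m) ]

  const : K.Carrier → Elem
  const c = term c M.ε

  mul : Elem → Elem → Elem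
  mul = cartesianProductWith λ (c , k) (d , l) → (c K.* d , k M.∙ l)

  rawRing : RawRing (a ⊔ b) (b ⊔ ℓ)
  rawRing = record
    { Carrier = Elem
    ; _≈_     = _≋_
    ; _+_     = _++_
    ; _*_     = mul
    ; -_      = map λ (c , k) → (K.- c , k)
    ; 0#      = []
    ; 1#      = const K.1#
    }

module Poly₁ {a ℓ : Level} (K : RawRing a ℓ) =
  MonoidAlgebra K +-0-rawMonoid _≟ℕ_

module Poly₂ {a ℓ : Level} (K : RawRing a ℓ) =
  MonoidAlgebra K (+-0-rawMonoid ×ᴹ +-0-rawMonoid) (×-decidable _≟ℕ_ _≟ℕ_)

-- The library composes left to right: (τ ∘ₚ σ) ⟨$⟩ʳ s = σ (τ s).

𝔖 : ℕ → Group 0ℓ 0ℓ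
𝔖 n = record
  { Carrier = Permutation′ n
  ; _≈_     = _≈_
  ; _∙_     = λ σ τ → τ ∘ₚ σ
  ; ε       = id
  ; _⁻¹     = flip
  ; isGroup = record
    { isMonoid = record
      { isSemigroup = record
        { isMagma = record
          { isEquivalence = record
            { refl  = λ _ → refl
            ; sym   = λ p i → sym (p i)
            ; trans = λ p q i → trans (p i) (q i)
            }
          ; ∙-cong = λ {σ} {σ′} {τ} p q i →
              trans (p (τ ⟨$⟩ʳ i)) (cong (σ′ ⟨$⟩ʳ_) (q i))
          }
        ; assoc = λ _ _ _ _ → refl
        }
      ; identity = (λ _ _ → refl) , (λ _ _ → refl)
      }
    ; inverse = (λ σ _ → inverseˡ σ) , (λ σ _ → inverseʳ σ)
    ; ⁻¹-cong = λ {σ} {τ} p i →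
        trans (cong (σ ⟨$⟩ˡ_) (sym (inverseʳ τ)))
          (trans (cong (σ ⟨$⟩ˡ_) (sym (p (τ ⟨$⟩ˡ i)))) (inverseˡ σ))
    }
  }

𝔖-setoid : ℕ → Setoid 0ℓ 0ℓ
𝔖-setoid n = Group.setoid (𝔖 n)

_≟ₚ_ : ∀ {n} → Decidable (_≈_ {n} {n})
σ ≟ₚ τ = all? λ i → (σ ⟨$⟩ʳ i) ≟ᶠ (τ ⟨$⟩ʳ i)

-- Every element of 𝔖ₙ exactly once up to ≈; see permutations-complete and
-- permutations-unique.
permutations : ∀ n → List (Permutation′ n)
permutations zero    = [ id ]
permutations (suc n) = cartesianProductWith (insert zero) (allFin (suc n)) (permutations n)

private
  insert-cong : ∀ {n} {i j : Fin (suc n)} {π ρ : Permutation′ n} →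
                i ≡ j → π ≈ ρ → insert zero i π ≈ insert zero j ρ
  insert-cong refl p zero    = refl
  insert-cong {i = i} {π = π} {ρ} refl p (suc k) =
    trans (insert-punchIn zero i π k)
      (trans (cong (punchIn i) (p k)) (sym (insert-punchIn zero i ρ k)))

  insert-injective : ∀ {n} {i j : Fin (suc n)} {π ρ : Permutation′ n} →
                     insert zero i π ≈ insert zero j ρ → i ≡ j × π ≈ ρ
  insert-injective {i = i} {π = π} {ρ} p with refl ← p zero = refl , λ k →
    punchIn-injective i _ _
      (trans (sym (insert-punchIn zero i π k)) (trans (p (suc k)) (insert-punchIn zero i ρ k)))

permutations-complete : ∀ {n} (π : Permutation′ n) →
                        Membership._∈_ (𝔖-setoid n) π (permutations n)
permutations-complete {zero}  π = here λ ()
permutations-complete {suc n} π =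
  Membershipₚ.∈-resp-≈ (𝔖-setoid (suc n))
    {x = insert zero (π ⟨$⟩ʳ zero) (remove zero π)} {y = π} (insert-remove zero π)
    (Membershipₚ.∈-cartesianProductWith⁺ (setoid (Fin (suc n))) (𝔖-setoid n) (𝔖-setoid (suc n))
      (λ {_} {_} {ρ} {σ} → insert-cong {π = ρ} {σ}) (∈-allFin (π ⟨$⟩ʳ zero)) (permutations-complete (remove zero π)))

permutations-unique : ∀ n → Unique.Unique (𝔖-setoid n) (permutations n)
permutations-unique zero    = All.[] AllPairs.∷ AllPairs.[]
permutations-unique (suc n) =
  Uniqueₚ.cartesianProductWith⁺ (setoid (Fin (suc n))) (𝔖-setoid n) (𝔖-setoid (suc n))
    (insert zero) (λ {_} {_} {ρ} {σ} → insert-injective {π = ρ} {σ}) (allFin⁺ (suc n)) (permutations-unique n)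

-- Positions are 0, …, n - 1, so the position cyclically following i is
-- i + 1 mod n, and the last position is compared with position 0.

CyclicDescent : ∀ {n} .{{_ : NonZero n}} → Permutation′ n → Pred (Fin n) 0ℓ
CyclicDescent {n} π i = π ⟨$⟩ʳ i >ᶠ π ⟨$⟩ʳ (suc (toℕ i) mod n)

cyclicDescent? : ∀ {n} .{{_ : NonZero n}} (π : Permutation′ n) →
                 Unary.Decidable (CyclicDescent π)
cyclicDescent? {n} π i = (π ⟨$⟩ʳ (suc (toℕ i) mod n)) <?ᶠ (π ⟨$⟩ʳ i)

cdes : ∀ {n} .{{_ : NonZero n}} → Permutation′ n → ℕ
cdes {n} π = length (filter (cyclicDescent? π) (allFin n))

ℚ[x] : RawRing 0ℓ 0ℓ
ℚ[x] = Poly₁.rawRing ℚ-rawRing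

fromℕ : ℕ → RawRing.Carrier ℚ[x]
fromℕ k = Poly₁.const ℚ-rawRing (ℤ.+ k / 1)

module _ where
  open RawRing ℚ[x]

  fallingFactorial : Carrier → ℕ → Carrier
  fallingFactorial p zero    = 1#
  fallingFactorial p (suc m) = fallingFactorial p m * (p + - fromℕ m)

  binomial : Carrier → ℕ → Carrier
  binomial p m =
    Poly₁.const ℚ-rawRing ((ℤ.+ 1 / (m !)) {{m !≢0}}) * fallingFactorial p m

module GroupAlgebra (n : ℕ) =
  MonoidAlgebra ℚ-rawRing (Group.rawMonoid (𝔖 n)) _≟ₚ_

ℚ𝔖 : ℕ → RawRing 0ℓ 0ℓ
ℚ𝔖 n = GroupAlgebra.rawRing n

ℚ𝔖[x] ℚ𝔖[x,y] : ℕ → RawRing 0ℓ 0ℓ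
ℚ𝔖[x]   n = Poly₁.rawRing (ℚ𝔖 n)
ℚ𝔖[x,y] n = Poly₂.rawRing (ℚ𝔖 n)

-- p ⊗ π is the product p π ∈ ℚ[𝔖ₙ][x]: each coefficient c of p becomes c·π.
_⊗_ : ∀ {n} → RawRing.Carrier ℚ[x] → Permutation′ n → RawRing.Carrier (ℚ𝔖[x] n)
_⊗_ {n} p π = map (λ (c , k) → (GroupAlgebra.term n c π , k)) p

φ : ∀ n .{{_ : NonZero n}} → RawRing.Carrier (ℚ𝔖[x] n)
φ n = Poly₁.const (ℚ𝔖 n) (GroupAlgebra.const n (ℤ.+ 1 / n)) *
      foldr _+_ 0#
        (map (λ π → binomial (x +ᵖ fromℕ (pred n) +ᵖ -ᵖ fromℕ (cdes π)) (pred n) ⊗ π)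
             (permutations n))
  where
  open RawRing (ℚ𝔖[x] n)
  open RawRing ℚ[x] using () renaming (_+_ to _+ᵖ_; -_ to -ᵖ_)
  x = Poly₁.term ℚ-rawRing (ℤ.+ 1 / 1) 1

X Y : ∀ {n} → RawRing.Carrier (ℚ𝔖[x,y] n)
X {n} = Poly₂.term (ℚ𝔖 n) (RawRing.1# (ℚ𝔖 n)) (1 , 0)
Y {n} = Poly₂.term (ℚ𝔖 n) (RawRing.1# (ℚ𝔖 n)) (0 , 1)

infix 9 _⟨_⟩

-- f ⟨ p ⟩ = Σₖ aₖ pᵏ for f = Σₖ aₖ xᵏ: substitution of p for x.
_⟨_⟩ : ∀ {n} → RawRing.Carrier (ℚ𝔖[x] n) → RawRing.Carrier (ℚ𝔖[x,y] n) →
       RawRing.Carrier (ℚ𝔖[x,y] n)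
_⟨_⟩ {n} f p = foldr (λ (a , k) s → Poly₂.const (ℚ𝔖 n) a * p ^ k + s) 0# f
  where
  open RawRing (ℚ𝔖[x,y] n)
  _^_ = power rawSemiring
  infixr 8 _^_

{-# OPTIONS --safe #-}

-- It suffices to compare both sides at positive integers x = k, y = l. Sorting the labellings
-- f : [n] → [k] stably gives Ψₖ = Σ_f sort(f) in ℚ[𝔖ₙ]. The coefficient of π in Ψₖ is
-- binom(k + n - 1 - des π, n), and comparing pairs of labels lexicographically shows
-- ΨₖΨₗ = Ψₖₗ. Let ω be the n-cycle i ↦ i + 1 and Ω = Σ ωⁱ. Among the rotations πωⁱ, exactly
-- cdes π have cdes π - 1 descents and the others have cdes π, so Pascal's rule yields
-- ΨₖΩ = k n φ(k). As cdes(ωπ) = cdes π, also Ω φ(l) = n φ(l), hence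
-- k n φ(k) φ(l) = Ψₖ Ω φ(l) = n Ψₖ φ(l) = Ψₖ Ψₗ Ω / l = Ψₖₗ Ω / l = k n φ(kl).

module Submission where

open import Defs
open import Algebra.Bundles using (CommutativeSemiring; Group; Monoid)
open import Algebra.Bundles.Raw using (RawMonoid; RawRing)
open import Algebra.Construct.DirectProduct using () renaming (rawMonoid to _×ᴹ_)
open import Algebra.Core using (Op₁; Op₂)
open import Algebra.Definitions.RawSemiring using () renaming (_^_ to power)
import Algebra.Solver.Ring.NaturalCoefficients.Default
open import Algebra.Structures using (IsCommutativeRing)
open import Data.Bool.Base using (true; false; if_then_else_)
open import Data.Fin.Base as Fin using (Fin; zero; suc; toℕ; punchIn; combine; remQuot; inject₁)
open import Data.Fin.Permutation as Perm
  using (Permutation′; permutation; _⟨$⟩ʳ_; _⟨$⟩ˡ_; _∘ₚ_; flip; insert; insert-punchIn; inverseˡ; inverseʳ)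
  renaming (_≈_ to _≈ₚ_)
open import Data.Fin.Properties as Finₚ using (toℕ-combine; combine-monoˡ-<; remQuot-combine; combine-remQuot)
open import Data.Fin.Relation.Unary.Top using (view; ‵fromℕ; ‵inj₁)
import Data.Integer.Base as ℤ
import Data.Integer.Properties as ℤₚ
open import Data.List.Base
  using (List; []; _∷_; _++_; allFin; cartesianProductWith; filter; foldr; length; map)
import Data.List.Membership.Propositional as Membershipₚ
open import Data.List.Membership.Propositional.Properties using (∈-allFin; ∈-cartesianProductWith⁺)
import Data.List.Membership.Setoid as Membership
open import Data.List.Properties using (map-tabulate)
open import Data.List.Relation.Unary.All as All using ([])
open import Data.List.Relation.Unary.AllPairs using ([]; _∷_)
open import Data.List.Relation.Unary.Any using (here; there)
import Data.List.Relation.Unary.Unique.Propositional as Uniqueₚ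
open import Data.List.Relation.Unary.Unique.Propositional.Properties using (allFin⁺; cartesianProductWith⁺)
import Data.List.Relation.Unary.Unique.Setoid as Unique
open import Data.Nat.Base as ℕ
  using (ℕ; zero; suc; NonZero; _≤_; _<_; z≤n; s≤s; _∸_; _!; +-0-rawMonoid)
open import Data.Nat.DivMod using (_mod_; _%_; m<n⇒m%n≡m; n%n≡0)
open import Data.Nat.Properties as ℕₚ using (_≤?_; _!≢0) renaming (_≟_ to _≟ℕ_)
import Data.Nat.Solver as ℕ-Solver
open import Data.Product.Base as Product using (∃; _×_; _,_; proj₁; proj₂)
open import Data.Product.Properties using (≡-dec)
open import Data.Product.Relation.Binary.Pointwise.NonDependent using (×-decidable)
open import Data.Rational.Base as ℚ using (ℚ; _/_; toℚᵘ)
import Data.Rational.Properties as ℚₚ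
open import Data.Rational.Unnormalised.Base as ℚᵘ using (mkℚᵘ; *≡*)
import Data.Rational.Unnormalised.Properties as ℚᵘₚ
open import Data.Sum.Base as Sum using (_⊎_; inj₁; inj₂)
open import Data.Vec.Base as Vec using (Vec; []; _∷_; lookup; tabulate; zipWith)
open import Data.Vec.Properties as Vecₚ using (lookup∘tabulate; lookup-zipWith)
open import Function.Base using (_∘_)
open import Level using (0ℓ)
open import Relation.Binary.Bundles using (Setoid)
open import Relation.Binary.Definitions using (Decidable; tri<; tri≈; tri>)
open import Relation.Binary.PropositionalEquality
  using (_≡_; _≢_; refl; sym; trans; cong; cong₂; subst; subst₂; setoid; module ≡-Reasoning)
open import Relation.Nullary using (Dec; yes; no; does; ¬_; contradiction)
open import Relation.Nullary.Decidable using (_×-dec_; _→-dec_)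
open import Relation.Unary using (Pred) renaming (Decidable to Decidable₁)

-- Evaluation at integers and comparison of coefficients are handled by one device: a formal sum Σ
-- a·g, in which terms may repeat, is read as the functional h ↦ Σ a h(g). Taking for h the powers
-- of a number gives a value, taking an indicator gives a coefficient, and `polynomial-ext` leads
-- from the first to the second, one indeterminate at a time. The integers k and l are positive
-- because the identity between values is first proved with the extra factors k and l, which then
-- have to be cancelled. The scalars form any commutative ring in which the factorials are
-- invertible. This supplies the binomial coefficients, and it also makes every positive integer
-- cancellable, which replaces the absence of zero divisors in the argument that a polynomial with
-- infinitely many integer roots vanishes.

private variable
  A B C P Q : Set
  k l m n : ℕ

-- Sorting

Increasing : (Fin n → ℕ) → Set
Increasing u = ∀ i j → i Fin.< j → u i < u j

increasing? : (u : Fin n → ℕ) → Dec (Increasing u)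
increasing? u = Finₚ.all? λ i → Finₚ.all? λ j → (i Finₚ.<? j) →-dec (u i ℕₚ.<? u j)

increasing-reflects : {u : Fin n → ℕ} → Increasing u → ∀ {i j} → u i < u j → i Fin.< j
increasing-reflects {u = u} inc {i} {j} ui<uj with Finₚ.<-cmp i j
... | tri< i<j _ _    = i<j
... | tri≈ _ refl _   = contradiction ui<uj (ℕₚ.<-irrefl refl)
... | tri> _ _ j<i    = contradiction ui<uj (ℕₚ.<-asym (inc j i j<i))

increasing-cong : {u v : Fin n → ℕ} → (∀ i → u i ≡ v i) → Increasing u → Increasing v
increasing-cong e inc i j i<j = subst₂ _<_ (e i) (e j) (inc i j i<j)

-- The bound `c` varies for the sake of the induction: dropping the first entry raises the lower
-- bound of the rest by one.
increasing-lower : ∀ {u : Fin n → ℕ} c → Increasing u → (∀ i → c ≤ u i) → ∀ i → c ℕ.+ toℕ i ≤ u i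
increasing-lower c inc c≤u zero = subst (_≤ _) (sym (ℕₚ.+-identityʳ c)) (c≤u zero)
increasing-lower {u = u} c inc c≤u (suc i) = subst (_≤ u (suc i)) (sym (ℕₚ.+-suc c (toℕ i)))
  (increasing-lower (suc c) (λ i j i<j → inc (suc i) (suc j) (s≤s i<j))
    (λ j → ℕₚ.≤-<-trans (c≤u zero) (inc zero (suc j) (s≤s z≤n))) i)

argmin : (u : Fin (suc n) → ℕ) → ∃ λ j → ∀ i → u j ≤ u i
argmin {zero}  u = zero , λ { zero → ℕₚ.≤-refl }
argmin {suc n} u with argmin (u ∘ suc)
... | j , min with ℕₚ.≤-total (u zero) (u (suc j))
... | inj₁ u0≤uj = zero , λ { zero → ℕₚ.≤-refl ; (suc i) → ℕₚ.≤-trans u0≤uj (min i) }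
... | inj₂ uj≤u0 = suc j , λ { zero → uj≤u0 ; (suc i) → min i }

sort : ∀ n (u : Fin n → ℕ) → (∀ {i j} → u i ≡ u j → i ≡ j) →
       ∃ λ (σ : Permutation′ n) → Increasing (u ∘ (σ ⟨$⟩ʳ_))
sort zero    u inj = Perm.id , λ ()
sort (suc n) u inj with argmin u
... | j , min with sort n (u ∘ punchIn j) (Finₚ.punchIn-injective j _ _ ∘ inj)
... | τ , inc = insert zero j τ , sorted
  where
  sorted : Increasing (u ∘ (insert zero j τ ⟨$⟩ʳ_))
  sorted zero (suc b) _ = subst (λ x → u j < u x) (sym (insert-punchIn zero j τ b))
    (ℕₚ.≤∧≢⇒< (min _) (Finₚ.punchInᵢ≢i j (τ ⟨$⟩ʳ b) ∘ sym ∘ inj))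
  sorted (suc a) (suc b) (s≤s a<b) = subst₂ (λ x y → u x < u y)
    (sym (insert-punchIn zero j τ a)) (sym (insert-punchIn zero j τ b)) (inc a b a<b)

-- The map σ⁻¹τ is an increasing self-map of [n], hence nowhere below the identity. The same holds
-- for τ⁻¹σ, so both are the identity.
sort-unique : {u : Fin n → ℕ} (σ τ : Permutation′ n) →
              Increasing (u ∘ (σ ⟨$⟩ʳ_)) → Increasing (u ∘ (τ ⟨$⟩ʳ_)) → σ ≈ₚ τ
sort-unique {u = u} σ τ σ-inc τ-inc i =
  trans (cong (σ ⟨$⟩ʳ_) (Finₚ.toℕ-injective (ℕₚ.≤-antisym (below σ τ σ-inc τ-inc i) above))) (inverseʳ σ)
  where
  below : ∀ σ τ → Increasing (u ∘ (σ ⟨$⟩ʳ_)) → Increasing (u ∘ (τ ⟨$⟩ʳ_)) →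
          ∀ i → toℕ i ≤ toℕ (σ ⟨$⟩ˡ (τ ⟨$⟩ʳ i))
  below σ τ σ-inc τ-inc = increasing-lower 0 (λ i j i<j → increasing-reflects σ-inc
    (subst₂ (λ x y → u x < u y) (sym (inverseʳ σ)) (sym (inverseʳ σ)) (τ-inc i j i<j))) (λ _ → z≤n)
  above : toℕ (σ ⟨$⟩ˡ (τ ⟨$⟩ʳ i)) ≤ toℕ i
  above = subst₂ _≤_ refl (cong toℕ (trans (cong (τ ⟨$⟩ˡ_) (inverseʳ σ)) (inverseˡ τ)))
    (below τ σ τ-inc σ-inc (σ ⟨$⟩ˡ (τ ⟨$⟩ʳ i)))

-- Lexicographic comparison and stable sorting

combine-<⁺ : ∀ {a b : Fin k} {u v : Fin n} → a Fin.< b ⊎ (a ≡ b × u Fin.< v) → combine a u Fin.< combine b v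
combine-<⁺ (inj₁ a<b) = combine-monoˡ-< _ _ a<b
combine-<⁺ {n = n} {a = a} {u = u} {v} (inj₂ (refl , u<v)) =
  subst₂ _<_ (sym (toℕ-combine a u)) (sym (toℕ-combine a v)) (ℕₚ.+-monoʳ-< (n ℕ.* toℕ a) u<v)

combine-<⁻ : ∀ {a b : Fin k} {u v : Fin n} → combine a u Fin.< combine b v → a Fin.< b ⊎ (a ≡ b × u Fin.< v)
combine-<⁻ {n = n} {a} {b} {u} {v} lt with Finₚ.<-cmp a b
... | tri< a<b _ _  = inj₁ a<b
... | tri> _ _ b<a  = contradiction lt (ℕₚ.<-asym (combine-monoˡ-< v u b<a))
... | tri≈ _ refl _ = inj₂ (refl , ℕₚ.+-cancelˡ-< (n ℕ.* toℕ a) _ _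
  (subst₂ _<_ (toℕ-combine a u) (toℕ-combine a v) lt))

-- Makes a pair of labels with a position a lexicographic triple, however it is bracketed. The two
-- sides lie in different types `Fin _`, so they are compared as numbers.
combine-assoc : ∀ (a : Fin l) (b : Fin k) (u : Fin n) →
                toℕ (combine (combine a b) u) ≡ toℕ (combine a (combine b u))
combine-assoc {k = k} {n} a b u = begin
  toℕ (combine (combine a b) u)                      ≡⟨ toℕ-combine (combine a b) u ⟩
  n ℕ.* toℕ (combine a b) ℕ.+ toℕ u                  ≡⟨ cong (λ x → n ℕ.* x ℕ.+ toℕ u) (toℕ-combine a b) ⟩
  n ℕ.* (k ℕ.* toℕ a ℕ.+ toℕ b) ℕ.+ toℕ u            ≡⟨ solve 5
    (λ n k a b u → n :* (k :* a :+ b) :+ u := (k :* n) :* a :+ (n :* b :+ u)) refl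
    n k (toℕ a) (toℕ b) (toℕ u) ⟩
  (k ℕ.* n) ℕ.* toℕ a ℕ.+ (n ℕ.* toℕ b ℕ.+ toℕ u)    ≡⟨ cong ((k ℕ.* n) ℕ.* toℕ a ℕ.+_) (toℕ-combine b u) ⟨
  (k ℕ.* n) ℕ.* toℕ a ℕ.+ toℕ (combine b u)          ≡⟨ toℕ-combine a (combine b u) ⟨
  toℕ (combine a (combine b u))                      ∎
  where
  open ≡-Reasoning
  open ℕ-Solver.+-*-Solver

-- Breaking ties between equal labels by position makes sorting stable.
key : Vec (Fin k) n → Fin n → ℕ
key f u = toℕ (combine (lookup f u) u)

key-injective : (f : Vec (Fin k) n) → ∀ {u v} → key f u ≡ key f v → u ≡ v
key-injective f {u} {v} e = Finₚ.combine-injectiveʳ (lookup f u) u (lookup f v) v (Finₚ.toℕ-injective e)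

Sorts : Permutation′ n → Vec (Fin k) n → Set
Sorts σ f = Increasing (key f ∘ (σ ⟨$⟩ʳ_))

sorts? : (σ : Permutation′ n) (f : Vec (Fin k) n) → Dec (Sorts σ f)
sorts? σ f = increasing? (key f ∘ (σ ⟨$⟩ʳ_))

permute : Permutation′ n → Vec (Fin k) n → Vec (Fin k) n
permute σ g = tabulate λ i → lookup g (σ ⟨$⟩ʳ i)

module _ {σ ρ : Permutation′ n} {f : Vec (Fin k) n} {g : Vec (Fin l) n} (σ-sorts : Sorts σ f) where
  private
    τ = ρ ∘ₚ flip σ

    key-permute : ∀ i → key (permute σ g) (τ ⟨$⟩ʳ i) ≡ toℕ (combine (lookup g (ρ ⟨$⟩ʳ i)) (σ ⟨$⟩ˡ (ρ ⟨$⟩ʳ i)))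
    key-permute i = cong (λ x → toℕ (combine x (σ ⟨$⟩ˡ (ρ ⟨$⟩ʳ i))))
      (trans (lookup∘tabulate _ (τ ⟨$⟩ʳ i)) (cong (lookup g) (inverseʳ σ)))

    key-zip : ∀ i → key (zipWith combine g f) i ≡ toℕ (combine (lookup g i) (combine (lookup f i) i))
    key-zip i = trans (cong (λ x → toℕ (combine x i)) (lookup-zipWith combine i g f))
      (combine-assoc (lookup g i) (lookup f i) i)

    rank-reflects : ∀ {u v} → σ ⟨$⟩ˡ u Fin.< σ ⟨$⟩ˡ v → key f u < key f v
    rank-reflects lt = subst₂ (λ u v → key f u < key f v) (inverseʳ σ) (inverseʳ σ) (σ-sorts _ _ lt)

    rank-preserves : ∀ {u v} → key f u < key f v → σ ⟨$⟩ˡ u Fin.< σ ⟨$⟩ˡ v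
    rank-preserves lt = increasing-reflects σ-sorts
      (subst₂ (λ u v → key f u < key f v) (sym (inverseʳ σ)) (sym (inverseʳ σ)) lt)

  -- Since σ sorts f, the position `σ ⟨$⟩ˡ u` is the rank of u in the order by (f(u), u). Breaking
  -- ties of `permute σ g` by position therefore means breaking ties of g by f and then by the
  -- original position, which is the order that the zipped labelling defines.
  sorts-zip : Sorts τ (permute σ g) → Sorts ρ (zipWith combine g f)
  sorts-zip s i j i<j = subst₂ _<_ (sym (key-zip _)) (sym (key-zip _))
    (combine-<⁺ {k = l} (Sum.map₂ (Product.map₂ rank-reflects)
        (combine-<⁻ {k = l} (subst₂ _<_ (key-permute i) (key-permute j) (s i j i<j)))))

  sorts-unzip : Sorts ρ (zipWith combine g f) → Sorts τ (permute σ g)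
  sorts-unzip s i j i<j = subst₂ _<_ (sym (key-permute i)) (sym (key-permute j))
    (combine-<⁺ {k = l} (Sum.map₂ (Product.map₂ rank-preserves)
        (combine-<⁻ {k = l} (subst₂ _<_ (key-zip _) (key-zip _) (s i j i<j)))))

-- Scalars in a commutative ring

module OverCommutativeRing {K : Set} {plus times : Op₂ K} {neg : Op₁ K} {0# 1# : K}
  (isCommutativeRing : IsCommutativeRing _≡_ plus times neg 0# 1#) where

  open IsCommutativeRing isCommutativeRing public
    using (+-comm; +-assoc; +-identityˡ; +-identityʳ; *-comm; *-assoc; *-identityˡ; *-identityʳ;
           zeroˡ; zeroʳ; distribˡ; distribʳ; -‿inverseʳ; -‿inverseˡ; isCommutativeSemiring)

  infixl 6 _+_ _-_
  infixl 7 _*_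
  infix  8 -_

  -_ : Op₁ K
  -_ = neg

  _+_ _*_ _-_ : Op₂ K
  _+_ = plus
  _*_ = times
  x - y = x + - y

  commutativeSemiring : CommutativeSemiring 0ℓ 0ℓ
  commutativeSemiring = record { isCommutativeSemiring = isCommutativeSemiring }

  open Algebra.Solver.Ring.NaturalCoefficients.Default commutativeSemiring public
    using (solve; con; _:+_; _:*_; _:=_)

  -- Finite sums and indicators

  ∑ : List A → (A → K) → K
  ∑ []       f = 0#
  ∑ (x ∷ xs) f = f x + ∑ xs f

  ∑-cong : ∀ (xs : List A) {f g : A → K} → (∀ x → f x ≡ g x) → ∑ xs f ≡ ∑ xs g
  ∑-cong []       e = refl
  ∑-cong (x ∷ xs) e = cong₂ _+_ (e x) (∑-cong xs e)

  ∑-zero : ∀ (xs : List A) → ∑ xs (λ _ → 0#) ≡ 0#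
  ∑-zero []       = refl
  ∑-zero (x ∷ xs) = trans (+-identityˡ _) (∑-zero xs)

  interchange : ∀ a b c d → (a + b) + (c + d) ≡ (a + c) + (b + d)
  interchange = solve 4 (λ a b c d → (a :+ b) :+ (c :+ d) := (a :+ c) :+ (b :+ d)) refl

  ∑-+ : ∀ (xs : List A) (f g : A → K) → ∑ xs (λ x → f x + g x) ≡ ∑ xs f + ∑ xs g
  ∑-+ []       f g = sym (+-identityˡ 0#)
  ∑-+ (x ∷ xs) f g = trans (cong (f x + g x +_) (∑-+ xs f g)) (interchange _ _ _ _)

  ∑-*ˡ : ∀ (xs : List A) c (f : A → K) → ∑ xs (λ x → c * f x) ≡ c * ∑ xs f
  ∑-*ˡ []       c f = sym (zeroʳ c)
  ∑-*ˡ (x ∷ xs) c f = trans (cong (c * f x +_) (∑-*ˡ xs c f)) (sym (distribˡ c _ _))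

  ∑-*ʳ : ∀ (xs : List A) c (f : A → K) → ∑ xs (λ x → f x * c) ≡ ∑ xs f * c
  ∑-*ʳ xs c f = trans (∑-cong xs λ _ → *-comm _ _) (trans (∑-*ˡ xs c f) (*-comm _ _))

  ∑-++ : ∀ (xs ys : List A) (f : A → K) → ∑ (xs ++ ys) f ≡ ∑ xs f + ∑ ys f
  ∑-++ []       ys f = sym (+-identityˡ _)
  ∑-++ (x ∷ xs) ys f = trans (cong (f x +_) (∑-++ xs ys f)) (sym (+-assoc _ _ _))

  ∑-map : ∀ (g : A → B) xs (f : B → K) → ∑ (map g xs) f ≡ ∑ xs (f ∘ g)
  ∑-map g []       f = refl
  ∑-map g (x ∷ xs) f = cong (f (g x) +_) (∑-map g xs f)

  ∑-swap : ∀ (xs : List A) (ys : List B) (f : A → B → K) →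
           ∑ xs (λ x → ∑ ys (f x)) ≡ ∑ ys (λ y → ∑ xs (λ x → f x y))
  ∑-swap []       ys f = sym (∑-zero ys)
  ∑-swap (x ∷ xs) ys f = trans (cong (∑ ys (f x) +_) (∑-swap xs ys f)) (sym (∑-+ ys _ _))

  ∑-product : ∀ (g : A → B → C) xs ys (f : C → K) →
              ∑ (cartesianProductWith g xs ys) f ≡ ∑ xs (λ x → ∑ ys (λ y → f (g x y)))
  ∑-product g []       ys f = refl
  ∑-product g (x ∷ xs) ys f =
    trans (∑-++ (map (g x) ys) _ f) (cong₂ _+_ (∑-map (g x) ys f) (∑-product g xs ys f))

  ⟦_⟧ : Dec P → K
  ⟦ d ⟧ = if does d then 1# else 0#

  ⟦⟧-yes : (d : Dec P) → P → ⟦ d ⟧ ≡ 1#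
  ⟦⟧-yes (yes _) p = refl
  ⟦⟧-yes (no ¬p) p = contradiction p ¬p

  ⟦⟧-no : (d : Dec P) → ¬ P → ⟦ d ⟧ ≡ 0#
  ⟦⟧-no (yes p) ¬p = contradiction p ¬p
  ⟦⟧-no (no _)  ¬p = refl

  ⟦⟧-⇔ : (d : Dec P) (e : Dec Q) → (P → Q) → (Q → P) → ⟦ d ⟧ ≡ ⟦ e ⟧
  ⟦⟧-⇔ (yes p) e f g = sym (⟦⟧-yes e (f p))
  ⟦⟧-⇔ (no ¬p) e f g = sym (⟦⟧-no e (¬p ∘ g))

  ⟦⟧-× : (d : Dec P) (e : Dec Q) → ⟦ d ×-dec e ⟧ ≡ ⟦ d ⟧ * ⟦ e ⟧
  ⟦⟧-× (yes p) e = sym (*-identityˡ _)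
  ⟦⟧-× (no ¬p) e = sym (zeroˡ _)

  ⟦⟧-* : (d : Dec P) {x y : K} → (P → x ≡ y) → ⟦ d ⟧ * x ≡ ⟦ d ⟧ * y
  ⟦⟧-* (yes p) e = cong (1# *_) (e p)
  ⟦⟧-* (no ¬p) e = trans (zeroˡ _) (sym (zeroˡ _))

  record Enumeration (S : Setoid 0ℓ 0ℓ) : Set where
    open Setoid S renaming (_≈_ to _∼_; refl to ∼-refl; sym to ∼-sym; trans to ∼-trans) public
    open Membership S using (_∈_)
    open Unique S using (Unique)
    infix 4 _≟_
    field
      _≟_      : Decidable _∼_
      elements : List Carrier
      unique   : Unique elements
      complete : ∀ x → x ∈ elements

    private
      absent : ∀ {xs x a} → All.All (λ y → ¬ (x ∼ y)) xs → x ∼ a → (F : Carrier → K) →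
               ∑ xs (λ y → ⟦ y ≟ a ⟧ * F y) ≡ 0#
      absent All.[]       x∼a F = refl
      absent {y ∷ _} (x≁y All.∷ p) x∼a F =
        trans (cong₂ _+_ (trans (cong (_* F y) (⟦⟧-no (y ≟ _) λ y∼a → x≁y (∼-trans x∼a (∼-sym y∼a)))) (zeroˡ _))
                         (absent p x∼a F))
              (+-identityˡ _)

    ∑-∈ : ∀ {xs a} → Unique xs → a ∈ xs → (F : Carrier → K) → (∀ {x y} → x ∼ y → F x ≡ F y) →
          ∑ xs (λ x → ⟦ x ≟ a ⟧ * F x) ≡ F a
    ∑-∈ {x ∷ xs} {a} (x∉ ∷ u) (here a∼x) F F-cong =
      trans (cong₂ _+_ (trans (cong (_* F x) (⟦⟧-yes (x ≟ a) (∼-sym a∼x)))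
          (trans (*-identityˡ _) (F-cong (∼-sym a∼x))))
                       (absent x∉ (∼-sym a∼x) F))
            (+-identityʳ _)
    ∑-∈ {x ∷ xs} {a} (x∉ ∷ u) (there a∈) F F-cong =
      trans (cong₂ _+_ (trans (cong (_* F x) (⟦⟧-no (x ≟ a) (λ x∼a → distinct x∉ a∈ x∼a))) (zeroˡ _))
                       (∑-∈ u a∈ F F-cong))
            (+-identityˡ _)
      where
      distinct : ∀ {x a xs} → All.All (λ y → ¬ (x ∼ y)) xs → a ∈ xs → ¬ (x ∼ a)
      distinct (n All.∷ _) (here a∼y) x∼a = n (∼-trans x∼a a∼y)
      distinct (_ All.∷ p) (there a∈) x∼a = distinct p a∈ x∼a

    ∑-δ : ∀ a (F : Carrier → K) → (∀ {x y} → x ∼ y → F x ≡ F y) →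
          ∑ elements (λ x → ⟦ x ≟ a ⟧ * F x) ≡ F a
    ∑-δ a = ∑-∈ unique (complete a)

    count : ∀ a → ∑ elements (λ x → ⟦ x ≟ a ⟧) ≡ 1#
    count a = trans (∑-cong elements λ _ → sym (*-identityʳ _)) (∑-δ a (λ _ → 1#) λ _ → refl)

  module _ {S T : Setoid 0ℓ 0ℓ} (E : Enumeration S) (E′ : Enumeration T) where
    private
      module E = Enumeration E
      module E′ = Enumeration E′

    -- Double counting: each F (f x) is expanded as a sum over y against an indicator, and after
    -- exchanging the sums every y is hit exactly once, namely by the class of g y.
    ∑-reindex : (f : E.Carrier → E′.Carrier) (g : E′.Carrier → E.Carrier) →
                (∀ {x y} → f x E′.∼ y → x E.∼ g y) → (∀ {x y} → x E.∼ g y → f x E′.∼ y) →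
                (F : E′.Carrier → K) → (∀ {x y} → x E′.∼ y → F x ≡ F y) →
                ∑ E.elements (λ x → F (f x)) ≡ ∑ E′.elements F
    ∑-reindex f g to from F F-cong = begin
      ∑ E.elements (λ x → F (f x))
        ≡⟨ ∑-cong E.elements (λ x → sym (E′.∑-δ (f x) F F-cong)) ⟩
      ∑ E.elements (λ x → ∑ E′.elements λ y → ⟦ y E′.≟ f x ⟧ * F y)
        ≡⟨ ∑-swap E.elements E′.elements _ ⟩
      ∑ E′.elements (λ y → ∑ E.elements λ x → ⟦ y E′.≟ f x ⟧ * F y)
        ≡⟨ ∑-cong E′.elements (λ y → trans (∑-*ʳ E.elements (F y) _)
             (trans (cong (_* F y) (trans (∑-cong E.elements λ x →
                ⟦⟧-⇔ (y E′.≟ f x) (x E.≟ g y) (to ∘ E′.∼-sym) (E′.∼-sym ∘ from)) (E.count (g y))))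
                (*-identityˡ _))) ⟩
      ∑ E′.elements F ∎
      where open ≡-Reasoning

  -- The sorting permutations of labellings

  perms : ∀ n → Enumeration (𝔖-setoid n)
  perms n = record
    { _≟_ = _≟ₚ_ ; elements = permutations n
    ; unique = permutations-unique n ; complete = permutations-complete }

  fins : ∀ n → Enumeration (setoid (Fin n))
  fins n = record
    { _≟_ = Finₚ._≟_ ; elements = allFin n ; unique = allFin⁺ n ; complete = ∈-allFin }

  allVec : ∀ k n → List (Vec (Fin k) n)
  allVec k zero    = [] ∷ []
  allVec k (suc n) = cartesianProductWith _∷_ (allFin k) (allVec k n)

  vecs : ∀ k n → Enumeration (setoid (Vec (Fin k) n))
  vecs k n = record
    { _≟_ = Vecₚ.≡-dec Finₚ._≟_ ; elements = allVec k n
    ; unique = allVec-unique n ; complete = allVec-complete }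
    where
    open Membershipₚ using (_∈_)
    open Uniqueₚ using (Unique)
    allVec-unique : ∀ n → Unique (allVec k n)
    allVec-unique zero    = [] ∷ []
    allVec-unique (suc n) = cartesianProductWith⁺ _∷_ Vecₚ.∷-injective (allFin⁺ k) (allVec-unique n)
    allVec-complete : ∀ {n} (v : Vec (Fin k) n) → v ∈ allVec k n
    allVec-complete []      = here refl
    allVec-complete (a ∷ v) = ∈-cartesianProductWith⁺ _∷_ (∈-allFin a) (allVec-complete v)

  pairs : Enumeration (setoid A) → Enumeration (setoid B) → Enumeration (setoid (A × B))
  pairs E E′ = record
    { _≟_      = ≡-dec E._≟_ E′._≟_
    ; elements = cartesianProductWith _,_ E.elements E′.elements
    ; unique   = cartesianProductWith⁺ _,_ (λ { refl → refl , refl }) E.unique E′.unique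
    ; complete = λ (x , y) → ∈-cartesianProductWith⁺ _,_ (E.complete x) (E′.complete y)
    }
    where
    module E = Enumeration E
    module E′ = Enumeration E′

  -- The coefficient of σ in the sum, over all labellings f, of the permutation sorting f.
  Ψ : ℕ → Permutation′ n → K
  Ψ {n} k σ = ∑ (allVec k n) λ f → ⟦ sorts? σ f ⟧

  sorts-cong : ∀ {σ τ : Permutation′ n} (f : Vec (Fin k) n) → σ ≈ₚ τ → ⟦ sorts? σ f ⟧ ≡ ⟦ sorts? τ f ⟧
  sorts-cong {σ = σ} {τ} f e = ⟦⟧-⇔ (sorts? σ f) (sorts? τ f)
    (increasing-cong λ i → cong (key f) (e i)) (increasing-cong λ i → cong (key f) (sym (e i)))

  Ψ-cong : ∀ k {σ τ : Permutation′ n} → σ ≈ₚ τ → Ψ k σ ≡ Ψ k τ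
  Ψ-cong {n} k {σ} {τ} e = ∑-cong (allVec k n) λ f → sorts-cong {σ = σ} {τ} f e

  ∑-sorts : ∀ {n} (f : Vec (Fin k) n) → ∑ (permutations n) (λ σ → ⟦ sorts? σ f ⟧) ≡ 1#
  ∑-sorts {n = n} f with sort n (key f) (key-injective f)
  ... | τ , τ-sorts = trans
    (∑-cong (permutations n) λ σ → ⟦⟧-⇔ (sorts? σ f) (σ ≟ₚ τ)
      (λ σ-sorts → sort-unique {u = key f} σ τ σ-sorts τ-sorts)
      (λ e → increasing-cong (λ i → cong (key f) (sym (e i))) τ-sorts))
    (Enumeration.count (perms n) τ)

  ∑-permute : ∀ (σ : Permutation′ n) (F : Vec (Fin k) n → K) →
              ∑ (allVec k n) (λ g → F (permute σ g)) ≡ ∑ (allVec k n) F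
  ∑-permute {n} {k} σ F = ∑-reindex (vecs k n) (vecs k n) (permute σ) (permute (flip σ))
    (λ {x} {y} e → trans (sym (invert (flip σ) x)) (cong (permute (flip σ)) e))
    (λ {x} {y} e → trans (cong (permute σ) e) (invert σ y))
    F (cong F)
    where
    invert : ∀ (τ : Permutation′ n) (x : Vec (Fin k) n) → permute τ (permute (flip τ) x) ≡ x
    invert τ x = trans
      (Vecₚ.tabulate-cong λ i → trans (Vecₚ.lookup∘tabulate _ (τ ⟨$⟩ʳ i)) (cong (lookup x) (inverseˡ τ)))
      (Vecₚ.tabulate∘lookup x)

  ∑-zip : ∀ l k n (F : Vec (Fin (l ℕ.* k)) n → K) →
          ∑ (allVec k n) (λ f → ∑ (allVec l n) λ g → F (zipWith combine g f)) ≡ ∑ (allVec (l ℕ.* k) n) F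
  ∑-zip l k n F = trans (sym (∑-product _,_ (allVec k n) (allVec l n) λ (f , g) → F (zipWith combine g f)))
    (∑-reindex (pairs (vecs k n) (vecs l n)) (vecs (l ℕ.* k) n) (λ (f , g) → zipWith combine g f) split
      (λ { refl → sym (split-zip _ _) }) (λ { refl → zip-split _ }) F (cong F))
    where
    split : ∀ {n} → Vec (Fin (l ℕ.* k)) n → Vec (Fin k) n × Vec (Fin l) n
    split h = Vec.map (proj₂ ∘ remQuot {l} k) h , Vec.map (proj₁ ∘ remQuot k) h
    split-zip : ∀ {n} (f : Vec (Fin k) n) (g : Vec (Fin l) n) → split (zipWith combine g f) ≡ (f , g)
    split-zip []      []      = refl
    split-zip (a ∷ f) (b ∷ g) = cong₂ (λ (b , a) (f , g) → (a ∷ f) , (b ∷ g)) (remQuot-combine b a)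
        (split-zip f g)
    zip-split : ∀ {n} (h : Vec (Fin (l ℕ.* k)) n) →
                zipWith combine (proj₂ (split h)) (proj₁ (split h)) ≡ h
    zip-split []      = refl
    zip-split (c ∷ h) = cong₂ _∷_ (combine-remQuot {l} k c) (zip-split h)

  -- For fixed f only the permutation σ sorting f contributes. Relabelling g along σ turns the
  -- condition that σ⁻¹ρ sorts g into the condition that ρ sorts the zipped labelling, which no
  -- longer mentions σ. The zipped labellings run through all labellings by l k labels.
  Ψ-convolution : ∀ k l (ρ : Permutation′ n) →
                  ∑ (permutations n) (λ σ → Ψ k σ * Ψ l (ρ ∘ₚ flip σ)) ≡ Ψ (l ℕ.* k) ρ
  Ψ-convolution {n} k l ρ = begin
    ∑ Sₙ (λ σ → Ψ k σ * Ψ l (ρ ∘ₚ flip σ))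
      ≡⟨ ∑-cong Sₙ (λ σ → sym (∑-*ʳ Fs (Ψ l (ρ ∘ₚ flip σ)) _)) ⟩
    ∑ Sₙ (λ σ → ∑ Fs λ f → ⟦ sorts? σ f ⟧ * Ψ l (ρ ∘ₚ flip σ))
      ≡⟨ ∑-swap Sₙ Fs _ ⟩
    ∑ Fs (λ f → ∑ Sₙ λ σ → ⟦ sorts? σ f ⟧ * Ψ l (ρ ∘ₚ flip σ))
      -- The indicator in front allows σ to be taken to sort f while the second factor is rewritten.
      ≡⟨ ∑-cong Fs (λ f → ∑-cong Sₙ λ σ → ⟦⟧-* (sorts? σ f) λ σ-sorts →
           trans (sym (∑-permute σ λ g → ⟦ sorts? (ρ ∘ₚ flip σ) g ⟧))
                 (∑-cong Gs λ g → ⟦⟧-⇔ (sorts? (ρ ∘ₚ flip σ) (permute σ g)) (sorts? ρ (zipWith combine g f))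
                    (sorts-zip {σ = σ} {ρ} {f = f} {g = g} σ-sorts)
                        (sorts-unzip {σ = σ} {ρ} {f = f} {g = g} σ-sorts))) ⟩
    ∑ Fs (λ f → ∑ Sₙ λ σ → ⟦ sorts? σ f ⟧ * ∑ Gs λ g → ⟦ sorts? ρ (zipWith combine g f) ⟧)
      ≡⟨ ∑-cong Fs (λ f → trans (∑-*ʳ Sₙ (∑ Gs λ g → ⟦ sorts? ρ (zipWith combine g f) ⟧) _)
           (trans (cong (_* (∑ Gs λ g → ⟦ sorts? ρ (zipWith combine g f) ⟧)) (∑-sorts f)) (*-identityˡ _))) ⟩
    ∑ Fs (λ f → ∑ Gs λ g → ⟦ sorts? ρ (zipWith combine g f) ⟧)
      ≡⟨ ∑-zip l k n (λ h → ⟦ sorts? ρ h ⟧) ⟩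
    Ψ (l ℕ.* k) ρ ∎
    where
    open ≡-Reasoning
    Sₙ = permutations n
    Fs = allVec k n
    Gs = allVec l n

  -- Counting the labellings sorted by a permutation

  bit : ∀ {P : Set} → Dec P → ℕ
  bit d = if does d then 1 else 0

  -- The indicator of the P-partition condition for the word u: labels weakly increase, and strictly
  -- across each descent of u. As a product over neighbours it can be summed one label at a time.
  chain : (Fin (suc m) → Fin n) → Vec (Fin k) (suc m) → K
  chain {zero}  u _           = 1#
  chain {suc m} u (a ∷ b ∷ g) =
    ⟦ toℕ a ℕ.+ bit (u (suc zero) Finₚ.<? u zero) ≤? toℕ b ⟧ * chain (u ∘ suc) (b ∷ g)

  des : (Fin (suc m) → Fin n) → ℕ
  des {zero}  u = 0
  des {suc m} u = bit (u (suc zero) Finₚ.<? u zero) ℕ.+ des (u ∘ suc)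

  bit≤1 : ∀ {P : Set} (d : Dec P) → bit d ≤ 1
  bit≤1 (yes _) = s≤s z≤n
  bit≤1 (no _)  = z≤n

  des≤ : (u : Fin (suc m) → Fin n) → des u ≤ m
  des≤ {zero}  u = z≤n
  des≤ {suc m} u = ℕₚ.+-mono-≤ (bit≤1 (u (suc zero) Finₚ.<? u zero)) (des≤ (u ∘ suc))

  -- A tie a = b is broken by u < v, so it is allowed exactly when there is no descent from u to v.
  -- The summand `bit d` merges the cases a < b and a ≤ b into one inequality.
  combine-<⇔ : ∀ {a b : Fin k} {u v : Fin n} (d : Dec (v Fin.< u)) → u ≢ v →
               (combine a u Fin.< combine b v → toℕ a ℕ.+ bit d ≤ toℕ b) ×
               (toℕ a ℕ.+ bit d ≤ toℕ b → combine a u Fin.< combine b v)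
  combine-<⇔ {k = k} {a = a} {b} {u} {v} (yes v<u) u≢v rewrite ℕₚ.+-comm (toℕ a) 1 =
    (λ lt → to (combine-<⁻ lt)) , λ a<b → combine-<⁺ {k = k} (inj₁ a<b)
    where
    to : a Fin.< b ⊎ (a ≡ b × u Fin.< v) → a Fin.< b
    to (inj₁ a<b)       = a<b
    to (inj₂ (_ , u<v)) = contradiction u<v (ℕₚ.<-asym v<u)
  combine-<⇔ {k = k} {a = a} {b} {u} {v} (no v≮u) u≢v rewrite ℕₚ.+-identityʳ (toℕ a) =
    (λ lt → to (combine-<⁻ lt)) , λ a≤b → combine-<⁺ {k = k} (from (ℕₚ.m≤n⇒m<n∨m≡n a≤b))
    where
    to : a Fin.< b ⊎ (a ≡ b × u Fin.< v) → toℕ a ≤ toℕ b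
    to (inj₁ a<b)        = ℕₚ.<⇒≤ a<b
    to (inj₂ (refl , _)) = ℕₚ.≤-refl
    from : toℕ a < toℕ b ⊎ toℕ a ≡ toℕ b → a Fin.< b ⊎ (a ≡ b × u Fin.< v)
    from (inj₁ a<b) = inj₁ a<b
    from (inj₂ a≡b) = inj₂ (Finₚ.toℕ-injective a≡b , ℕₚ.≤∧≢⇒< (ℕₚ.≮⇒≥ v≮u) (u≢v ∘ Finₚ.toℕ-injective))

  -- By transitivity, an increasing sequence is determined by its neighbouring comparisons, and each
  -- of these is a factor of `chain`.
  chain-increasing : (u : Fin (suc m) → Fin n) → (∀ {i j} → u i ≡ u j → i ≡ j) → (g : Vec (Fin k) (suc m)) →
                     ⟦ increasing? (λ i → toℕ (combine (lookup g i) (u i))) ⟧ ≡ chain u g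
  chain-increasing {zero}  u inj g =
    ⟦⟧-yes (increasing? (λ i → toℕ (combine (lookup g i) (u i)))) λ { zero zero () }
  chain-increasing {suc m} u inj (a ∷ b ∷ g) = begin
    ⟦ increasing? w ⟧
      ≡⟨ ⟦⟧-⇔ (increasing? w) (first? ×-dec rest?)
           (λ inc → proj₁ step (inc zero (suc zero) (s≤s z≤n)) , λ i j i<j → inc (suc i) (suc j) (s≤s i<j))
           (λ (p , inc) → λ { zero (suc zero) _ → proj₂ step p
                            ; zero (suc (suc j)) _ → ℕₚ.<-trans (proj₂ step p) (inc zero (suc j) (s≤s z≤n))
                            ; (suc i) (suc j) (s≤s i<j) → inc i j i<j }) ⟩
    ⟦ first? ×-dec rest? ⟧
      ≡⟨ ⟦⟧-× first? rest? ⟩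
    ⟦ first? ⟧ * ⟦ rest? ⟧
      ≡⟨ cong (⟦ first? ⟧ *_) (chain-increasing (u ∘ suc) (Finₚ.suc-injective ∘ inj) (b ∷ g)) ⟩
    chain u (a ∷ b ∷ g) ∎
    where
    open ≡-Reasoning
    w : Fin (suc (suc m)) → ℕ
    w i = toℕ (combine (lookup (a ∷ b ∷ g) i) (u i))
    first? = toℕ a ℕ.+ bit (u (suc zero) Finₚ.<? u zero) ≤? toℕ b
    rest? = increasing? (w ∘ suc)
    step = combine-<⇔ {a = a} {b} {u zero} {u (suc zero)} (u (suc zero) Finₚ.<? u zero)
        (λ e → Finₚ.0≢1+n (inj e))

  ∑-allFin-suc : ∀ n (f : Fin (suc n) → K) → ∑ (allFin (suc n)) f ≡ f zero + ∑ (allFin n) (f ∘ suc)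
  ∑-allFin-suc n f = cong (f zero +_) (trans
    (cong (λ xs → ∑ xs f) (sym (map-tabulate {n = n} (λ i → i) suc))) (∑-map suc (allFin n) f))

  ∑-telescope : ∀ k s (G H : ℕ → K) → s ≤ k → (∀ b → b < k → G b ≡ H b + G (suc b)) →
                ∑ (allFin k) (λ b → ⟦ s ≤? toℕ b ⟧ * H (toℕ b)) + G k ≡ G s
  ∑-telescope zero    zero    G H s≤k step = +-identityˡ _
  ∑-telescope (suc k) zero    G H s≤k step = begin
    ∑ (allFin (suc k)) (λ b → ⟦ 0 ≤? toℕ b ⟧ * H (toℕ b)) + G (suc k)
      ≡⟨ cong (_+ _) (∑-allFin-suc k _) ⟩
    ⟦ 0 ≤? 0 ⟧ * H 0 + ∑ (allFin k) (λ b → ⟦ 0 ≤? suc (toℕ b) ⟧ * H (suc (toℕ b))) + G (suc k)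
      ≡⟨ +-assoc _ _ _ ⟩
    ⟦ 0 ≤? 0 ⟧ * H 0 + (∑ (allFin k) (λ b → ⟦ 0 ≤? suc (toℕ b) ⟧ * H (suc (toℕ b))) + G (suc k))
      ≡⟨ cong₂ _+_ (*-identityˡ _) (∑-telescope k 0 (G ∘ suc) (H ∘ suc) z≤n
          (λ b b<k → step (suc b) (s≤s b<k))) ⟩
    H 0 + G 1
      ≡⟨ step 0 (s≤s z≤n) ⟨
    G 0 ∎
    where open ≡-Reasoning
  ∑-telescope (suc k) (suc s) G H (s≤s s≤k) step = begin
    ∑ (allFin (suc k)) (λ b → ⟦ suc s ≤? toℕ b ⟧ * H (toℕ b)) + G (suc k)
      ≡⟨ cong (_+ _) (∑-allFin-suc k _) ⟩
    0# * H 0 + ∑ (allFin k) (λ b → ⟦ suc s ≤? suc (toℕ b) ⟧ * H (suc (toℕ b))) + G (suc k)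
      ≡⟨ cong (_+ _) (trans (cong₂ _+_ (zeroˡ _) (∑-cong (allFin k) λ b → cong (_* _)
           (⟦⟧-⇔ (suc s ≤? suc (toℕ b)) (s ≤? toℕ b) ℕₚ.≤-pred s≤s))) (+-identityˡ _)) ⟩
    ∑ (allFin k) (λ b → ⟦ s ≤? toℕ b ⟧ * H (suc (toℕ b))) + G (suc k)
      ≡⟨ ∑-telescope k s (G ∘ suc) (H ∘ suc) s≤k (λ b b<k → step (suc b) (s≤s b<k)) ⟩
    G (suc s) ∎
    where open ≡-Reasoning

  -- Integers and falling factorials in the ring

  ι : ℕ → K
  ι zero    = 0#
  ι (suc n) = 1# + ι n

  ι-+ : ∀ m n → ι (m ℕ.+ n) ≡ ι m + ι n
  ι-+ zero    n = sym (+-identityˡ _)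
  ι-+ (suc m) n = trans (cong (1# +_) (ι-+ m n)) (sym (+-assoc _ _ _))

  suc-* : ∀ x y → (1# + x) * y ≡ y + x * y
  suc-* x y = trans (distribʳ y 1# x) (cong (_+ x * y) (*-identityˡ y))

  ι-* : ∀ m n → ι (m ℕ.* n) ≡ ι m * ι n
  ι-* zero    n = sym (zeroˡ _)
  ι-* (suc m) n = trans (ι-+ n (m ℕ.* n))
    (trans (cong (ι n +_) (ι-* m n)) (sym (suc-* (ι m) (ι n))))

  x-y+y : ∀ x y → (x - y) + y ≡ x
  x-y+y x y = trans (+-assoc _ _ _) (trans (cong (x +_) (-‿inverseˡ y)) (+-identityʳ x))

  x+y-y : ∀ x y → (x + y) - y ≡ x
  x+y-y x y = trans (+-assoc _ _ _) (trans (cong (x +_) (-‿inverseʳ y)) (+-identityʳ x))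

  -‿unique : ∀ {x y d} → d + y ≡ x → x - y ≡ d
  -‿unique {y = y} {d} refl = x+y-y d y

  +-cancelʳ : ∀ z {x y} → x + z ≡ y + z → x ≡ y
  +-cancelʳ z {x} {y} e = trans (sym (x+y-y x z)) (trans (cong (_- z) e) (x+y-y y z))

  ∑-const : ∀ n x → ∑ (allFin n) (λ _ → x) ≡ ι n * x
  ∑-const zero    x = sym (zeroˡ x)
  ∑-const (suc n) x = trans (∑-allFin-suc n _)
    (trans (cong (x +_) (∑-const n x)) (sym (suc-* (ι n) x)))

  falling : K → ℕ → K
  falling z zero    = 1#
  falling z (suc j) = falling z j * (z - ι j)

  -- The recursion splits off the last factor of the product; here the first one is split off.
  falling-shift : ∀ z j → falling (1# + z) (suc j) ≡ (1# + z) * falling z j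
  falling-shift z zero = trans (*-comm _ _) (cong (_* 1#) (-‿unique (+-identityʳ _)))
  falling-shift z (suc j) = trans
    (cong₂ _*_ (falling-shift z j) (-‿unique (trans (solve 2
        (λ d i → d :+ (con 1 :+ i) := con 1 :+ (d :+ i)) refl (z - ι j) (ι j))
      (cong (1# +_) (x-y+y z (ι j))))))
    (*-assoc _ _ _)

  -- After splitting off the first factor, write it as 1 + z = (z - j) + (j + 1).
  falling-pascal : ∀ z j → falling (1# + z) (suc j) ≡ falling z (suc j) + ι (suc j) * falling z j
  falling-pascal z j = trans (falling-shift z j)
    (trans (cong (λ w → (1# + w) * falling z j) (sym (x-y+y z (ι j))))
      (solve 3 (λ d i f → (con 1 :+ (d :+ i)) :* f := f :* d :+ (con 1 :+ i) :* f) refl (z - ι j) (ι j)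
          (falling z j)))

  falling-vanish : ∀ {i j} → i < j → falling (ι i) j ≡ 0#
  falling-vanish {i} {suc j} i<sj with ℕₚ.m≤n⇒m<n∨m≡n (ℕₚ.≤-pred i<sj)
  ... | inj₁ i<j  = trans (cong (_* (ι i - ι j)) (falling-vanish i<j)) (zeroˡ _)
  ... | inj₂ refl = trans (cong (falling (ι i) i *_) (-‿inverseʳ (ι i))) (zeroʳ _)

  -- Formal sums as functionals

  rawRing : RawRing 0ℓ 0ℓ
  rawRing = record { Carrier = K ; _≈_ = _≡_ ; _+_ = plus ; _*_ = times ; -_ = neg ; 0# = 0# ; 1# = 1# }

  -- Formal sums are handled through the functionals they define: ⟪ f ⟫ h = Σ a h(g) for f = Σ a·g.
  ⟪_⟫ : List (K × B) → (B → K) → K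
  ⟪ f ⟫ h = ∑ f λ (a , g) → a * h g

  ⟪⟪_⟫⟫ : List (List (K × B) × C) → (C → B → K) → K
  ⟪⟪ p ⟫⟫ h = ∑ p λ (f , m) → ⟪ f ⟫ (h m)

  ⟪⟫-cong : ∀ (f : List (K × B)) {h h′ : B → K} → (∀ g → h g ≡ h′ g) → ⟪ f ⟫ h ≡ ⟪ f ⟫ h′
  ⟪⟫-cong f e = ∑-cong f λ (a , g) → cong (a *_) (e g)

  ⟪⟪⟫⟫-cong : ∀ (p : List (List (K × B) × C)) {h h′ : C → B → K} → (∀ m g → h m g ≡ h′ m g) →
      ⟪⟪ p ⟫⟫ h ≡ ⟪⟪ p ⟫⟫ h′
  ⟪⟪⟫⟫-cong p e = ∑-cong p λ (f , m) → ⟪⟫-cong f (e m)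

  ⟪⟫-∑ : ∀ (f : List (K × B)) (xs : List A) (h : A → B → K) →
         ⟪ f ⟫ (λ g → ∑ xs λ x → h x g) ≡ ∑ xs (λ x → ⟪ f ⟫ (h x))
  ⟪⟫-∑ f xs h = trans (∑-cong f λ (a , g) → sym (∑-*ˡ xs a _)) (∑-swap f xs _)

  ⟪⟫-*ˡ : ∀ (f : List (K × B)) c (h : B → K) → ⟪ f ⟫ (λ g → c * h g) ≡ c * ⟪ f ⟫ h
  ⟪⟫-*ˡ f c h = trans (∑-cong f λ (a , g) →
    solve 3 (λ a c x → a :* (c :* x) := c :* (a :* x)) refl a c (h g)) (∑-*ˡ f c _)

  module Algebra₁ (𝔾 : RawMonoid 0ℓ 0ℓ) (_≟_ : Decidable (RawMonoid._≈_ 𝔾)) where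
    open RawMonoid 𝔾 using (_∙_; ε) renaming (Carrier to G)
    open MonoidAlgebra rawRing 𝔾 _≟_

    coeff-⟪⟫ : ∀ f g → coeff f g ≡ ⟪ f ⟫ (λ k → ⟦ k ≟ g ⟧)
    coeff-⟪⟫ []            g = refl
    coeff-⟪⟫ ((a , k) ∷ f) g with does (k ≟ g)
    ... | true  = cong₂ _+_ (sym (*-identityʳ a)) (coeff-⟪⟫ f g)
    ... | false = cong₂ _+_ (sym (zeroʳ a)) (coeff-⟪⟫ f g)

    ⟪⟫-mul : ∀ f f′ (h : G → K) → ⟪ mul f f′ ⟫ h ≡ ⟪ f ⟫ (λ g → ⟪ f′ ⟫ λ g′ → h (g ∙ g′))
    ⟪⟫-mul f f′ h = trans (∑-product _ f f′ _) (∑-cong f λ (a , g) →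
      trans (∑-cong f′ λ (b , g′) → *-assoc a b _) (∑-*ˡ f′ a _))

    ⟪⟫-const : ∀ c (h : G → K) → ⟪ const c ⟫ h ≡ c * h ε
    ⟪⟫-const c h = +-identityʳ _

  module Algebra₂ (𝔾 : Monoid 0ℓ 0ℓ) (𝕄 : RawMonoid 0ℓ 0ℓ) (_≟ᴳ_ : Decidable (Monoid._≈_ 𝔾))
      (_≟ᴹ_ : Decidable (RawMonoid._≈_ 𝕄)) where
    open Monoid 𝔾 using (_≈_; ∙-cong; identityʳ) renaming (Carrier to G; _∙_ to _·_; ε to e; refl to ≈-refl)
    open RawMonoid 𝕄 using (_∙_; ε) renaming (Carrier to M)
    open Algebra₁ (Monoid.rawMonoid 𝔾) _≟ᴳ_
    module KG = MonoidAlgebra rawRing (Monoid.rawMonoid 𝔾) _≟ᴳ_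
    open MonoidAlgebra KG.rawRing 𝕄 _≟ᴹ_ renaming (rawRing to KG[M])

    coeff-coeff : ∀ p m g → KG.coeff (coeff p m) g ≡ ⟪⟪ p ⟫⟫ (λ m′ g′ → ⟦ m′ ≟ᴹ m ⟧ * ⟦ g′ ≟ᴳ g ⟧)
    coeff-coeff p m g = trans (coeff-⟪⟫ (coeff p m) g) (go p)
      where
      go : ∀ p → ⟪ coeff p m ⟫ (λ k → ⟦ k ≟ᴳ g ⟧) ≡ ⟪⟪ p ⟫⟫ (λ m′ g′ → ⟦ m′ ≟ᴹ m ⟧ * ⟦ g′ ≟ᴳ g ⟧)
      go []            = refl
      go ((f , k) ∷ p) with does (k ≟ᴹ m)
      ... | true  = trans (∑-++ f (coeff p m) _) (cong₂ _+_ (⟪⟫-cong f λ _ → sym (*-identityˡ _)) (go p))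
      ... | false = trans (go p) (sym (trans (cong (_+ _) (trans (⟪⟫-*ˡ f 0# _) (zeroˡ _))) (+-identityˡ _)))

    ⟪⟪⟫⟫-mul : ∀ p q (h : M → G → K) →
               ⟪⟪ mul p q ⟫⟫ h ≡ ⟪⟪ p ⟫⟫ (λ m g → ⟪⟪ q ⟫⟫ λ m′ g′ → h (m ∙ m′) (g · g′))
    ⟪⟪⟫⟫-mul p q h = trans (∑-product _ p q _) (∑-cong p λ (f , m) →
      trans (∑-cong q λ (f′ , m′) → ⟪⟫-mul f f′ (h (m ∙ m′)))
        (sym (⟪⟫-∑ f q λ (f′ , m′) g → ⟪ f′ ⟫ λ g′ → h (m ∙ m′) (g · g′))))

    ⟪⟪⟫⟫-const : ∀ f (h : M → G → K) → ⟪⟪ const f ⟫⟫ h ≡ ⟪ f ⟫ (h ε)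
    ⟪⟪⟫⟫-const f h = +-identityʳ _

    -- Group laws such as g · e ≈ g hold only up to `_≈_`, and equality of permutations is
    -- pointwise, so test functions must be compatible with it.
    Respectful : (M → G → K) → Set
    Respectful h = ∀ m {g g′} → g ≈ g′ → h m g ≡ h m g′

    open RawRing KG[M] using (rawSemiring)

    -- The hypothesis on p says that it acts as a single monomial `m 1` with coefficient the unit of
    -- the group algebra; `m k` is the exponent of its k-th power. This covers x, y and xy at once,
    -- with exponents (k , 0), (0 , k) and (k , k).
    ⟪⟪⟫⟫-power : ∀ p (m : ℕ → M) → m 0 ≡ ε → (∀ k → m (suc k) ≡ m 1 ∙ m k) →
                 (∀ h → Respectful h → ⟪⟪ p ⟫⟫ h ≡ h (m 1) e) →
                 ∀ k h → Respectful h → ⟪⟪ power rawSemiring p k ⟫⟫ h ≡ h (m k) e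
    ⟪⟪⟫⟫-power p m m0 m+ p≡ zero h resp = begin
      ⟪⟪ const (KG.const 1#) ⟫⟫ h ≡⟨ ⟪⟪⟫⟫-const (KG.const 1#) h ⟩
      ⟪ KG.const 1# ⟫ (h ε)       ≡⟨ trans (⟪⟫-const 1# (h ε)) (*-identityˡ _) ⟩
      h ε e                       ≡⟨ cong (λ m → h m e) m0 ⟨
      h (m 0) e                   ∎
      where open ≡-Reasoning
    ⟪⟪⟫⟫-power p m m0 m+ p≡ (suc k) h resp = begin
      ⟪⟪ mul p (power rawSemiring p k) ⟫⟫ h
        ≡⟨ ⟪⟪⟫⟫-mul p (power rawSemiring p k) h ⟩
      ⟪⟪ p ⟫⟫ (λ m₁ g → ⟪⟪ power rawSemiring p k ⟫⟫ λ m′ g′ → h (m₁ ∙ m′) (g · g′))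
        ≡⟨ ⟪⟪⟫⟫-cong p (λ m₁ g → trans
             (⟪⟪⟫⟫-power p m m0 m+ p≡ k (λ m′ g′ → h (m₁ ∙ m′) (g · g′))
                 (λ m′ e → resp (m₁ ∙ m′) (∙-cong ≈-refl e)))
             (resp (m₁ ∙ m k) (identityʳ g))) ⟩
      ⟪⟪ p ⟫⟫ (λ m₁ g → h (m₁ ∙ m k) g)
        ≡⟨ p≡ (λ m₁ → h (m₁ ∙ m k)) (λ m₁ → resp (m₁ ∙ m k)) ⟩
      h (m 1 ∙ m k) e
        ≡⟨ cong (λ m → h m e) (m+ k) ⟨
      h (m (suc k)) e ∎
      where open ≡-Reasoning

    -- Over ℚ and the symmetric group this is `_⟨_⟩` by definition.
    substitute : List (KG.Elem × ℕ) → Elem → Elem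
    substitute f p = foldr (λ (a , k) s → mul (const a) (power rawSemiring p k) ++ s) [] f

    ⟪⟪⟫⟫-substitute : ∀ f p (m : ℕ → M) → m 0 ≡ ε → (∀ k → m (suc k) ≡ m 1 ∙ m k) → (∀ k → ε ∙ m k ≡ m k) →
                      (∀ h → Respectful h → ⟪⟪ p ⟫⟫ h ≡ h (m 1) e) →
                      ∀ h → Respectful h → ⟪⟪ substitute f p ⟫⟫ h ≡ ⟪⟪ f ⟫⟫ (λ k g → h (m k) g)
    ⟪⟪⟫⟫-substitute []            p m m0 m+ εm p≡ h resp = refl
    ⟪⟪⟫⟫-substitute ((a , k) ∷ f) p m m0 m+ εm p≡ h resp =
      trans (∑-++ (mul (const a) pᵏ) (substitute f p) _)
        (cong₂ _+_ head (⟪⟪⟫⟫-substitute f p m m0 m+ εm p≡ h resp))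
      where
      open ≡-Reasoning
      pᵏ = power rawSemiring p k
      head : ⟪⟪ mul (const a) pᵏ ⟫⟫ h ≡ ⟪ a ⟫ (λ g → h (m k) g)
      head = begin
        ⟪⟪ mul (const a) pᵏ ⟫⟫ h
          ≡⟨ ⟪⟪⟫⟫-mul (const a) pᵏ h ⟩
        ⟪⟪ const a ⟫⟫ (λ m₁ g → ⟪⟪ pᵏ ⟫⟫ λ m′ g′ → h (m₁ ∙ m′) (g · g′))
          ≡⟨ ⟪⟪⟫⟫-const a (λ m₁ g → ⟪⟪ pᵏ ⟫⟫ λ m′ g′ → h (m₁ ∙ m′) (g · g′)) ⟩
        ⟪ a ⟫ (λ g → ⟪⟪ pᵏ ⟫⟫ λ m′ g′ → h (ε ∙ m′) (g · g′))
          ≡⟨ ⟪⟫-cong a (λ g → trans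
               (⟪⟪⟫⟫-power p m m0 m+ p≡ k (λ m′ g′ → h (ε ∙ m′) (g · g′))
                   (λ m′ e → resp (ε ∙ m′) (∙-cong ≈-refl e)))
               (trans (cong (λ m₁ → h m₁ (g · e)) (εm k)) (resp (m k) (identityʳ g)))) ⟩
        ⟪ a ⟫ (λ g → h (m k) g) ∎

  -- Binomial coefficients with arbitrary upper entry

  module Binomial (invFact : ℕ → K) (invFact-inverse : ∀ n → ι (n !) * invFact n ≡ 1#) where

    invFact-zero : invFact 0 ≡ 1#
    invFact-zero = trans (sym (trans (cong (_* _) (+-identityʳ 1#)) (*-identityˡ _))) (invFact-inverse 0)

    invFact-suc : ∀ j → ι (suc j) * invFact (suc j) ≡ invFact j
    invFact-suc j = begin
      s * c′               ≡⟨ *-identityʳ _ ⟨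
      s * c′ * 1#          ≡⟨ cong (s * c′ *_) (invFact-inverse j) ⟨
      s * c′ * (f * c)     ≡⟨ solve 4 (λ s c′ f c → s :* c′ :* (f :* c) := s :* f :* c′ :* c) refl s c′ f c ⟩
      s * f * c′ * c       ≡⟨ cong (λ x → x * c′ * c) (ι-* (suc j) (j !)) ⟨
      ι (suc j !) * c′ * c ≡⟨ cong (_* c) (invFact-inverse (suc j)) ⟩
      1# * c               ≡⟨ *-identityˡ c ⟩
      c                    ∎
      where
      open ≡-Reasoning
      s = ι (suc j)
      f = ι (j !)
      c = invFact j
      c′ = invFact (suc j)

    -- A positive integer k + 1 divides (k + 1)!, so it is a unit with inverse k! / (k + 1)!.
    ι-cancel : ∀ k {x y} → ι (suc k) * x ≡ ι (suc k) * y → x ≡ y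
    ι-cancel k {x} {y} e = trans (sym (undo x)) (trans (cong (λ z → ι (k !) * invFact (suc k) * z) e) (undo y))
      where
      undo : ∀ z → ι (k !) * invFact (suc k) * (ι (suc k) * z) ≡ z
      undo z = trans (solve 4 (λ f c s z → f :* c :* (s :* z) := f :* (s :* c) :* z) refl (ι (k !))
          (invFact (suc k)) (ι (suc k)) z)
        (trans (cong (λ x → ι (k !) * x * z) (invFact-suc k))
            (trans (cong (_* z) (invFact-inverse k)) (*-identityˡ z)))

    binom : K → ℕ → K
    binom z j = invFact j * falling z j

    pascal : ∀ z j → binom (1# + z) (suc j) ≡ binom z (suc j) + binom z j
    pascal z j = begin
      c′ * falling (1# + z) (suc j)                   ≡⟨ cong (c′ *_) (falling-pascal z j) ⟩
      c′ * (falling z (suc j) + ι (suc j) * falling z j)   ≡⟨ solve 4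
          (λ c g s f → c :* (g :+ s :* f) := c :* g :+ s :* c :* f) refl c′ (falling z (suc j))
              (ι (suc j)) (falling z j) ⟩
      c′ * falling z (suc j) + ι (suc j) * c′ * falling z j ≡⟨ cong
          (λ x → c′ * falling z (suc j) + x * falling z j) (invFact-suc j) ⟩
      binom z (suc j) + binom z j                ∎
      where
      open ≡-Reasoning
      c′ = invFact (suc j)

    absorb : ∀ z j → (z - ι j) * binom z j ≡ ι (suc j) * binom z (suc j)
    absorb z j = trans (cong (λ x → (z - ι j) * (x * falling z j)) (sym (invFact-suc j)))
      (solve 4 (λ d s c f → d :* (s :* c :* f) := s :* (c :* (f :* d))) refl (z - ι j) (ι (suc j))
          (invFact (suc j)) (falling z j))

    binom-vanish : ∀ {i j} → i < j → binom (ι i) j ≡ 0#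
    binom-vanish i<j = trans (cong (_ *_) (falling-vanish i<j)) (zeroʳ _)

    -- The summands telescope by Pascal's rule; the last term is binom(m - d, m + 1) = 0.
    ∑-binom : ∀ m d s → s ≤ k → ∑ (allFin k) (λ b → ⟦ s ≤? toℕ b ⟧ * binom (ι (k ℕ.+ (m ∸ d) ∸ suc (toℕ b))) m)
                              ≡ binom (ι (k ℕ.+ (m ∸ d) ∸ s)) (suc m)
    ∑-binom {k} m d s s≤k = trans (sym (trans (cong (∑ (allFin k)
        (λ b → ⟦ s ≤? toℕ b ⟧ * H (toℕ b)) +_) Gk≡0) (+-identityʳ _)))
      (∑-telescope k s G H s≤k step)
      where
      M = k ℕ.+ (m ∸ d)
      G H : ℕ → K
      G b = binom (ι (M ∸ b)) (suc m)
      H b = binom (ι (M ∸ suc b)) m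
      Gk≡0 : G k ≡ 0#
      Gk≡0 = trans (cong (λ x → binom (ι x) (suc m)) (ℕₚ.m+n∸m≡n k (m ∸ d))) (binom-vanish (s≤s (ℕₚ.m∸n≤m m d)))
      step : ∀ b → b < k → G b ≡ H b + G (suc b)
      step b b<k = trans (cong (λ x → binom (ι x) (suc m)) (ℕₚ.+-∸-assoc 1 (ℕₚ.≤-trans b<k (ℕₚ.m≤m+n k _))))
        (trans (pascal (ι (M ∸ suc b)) m) (+-comm _ _))

    -- Adding to each label its index and subtracting the number of descents passed so far makes the
    -- labels strictly increasing. What is counted are then the m-subsets of the numbers above a and
    -- below k + (m - des u). The proof reaches this count by summing over the second label.
    ∑-chain-from : ∀ {m} (u : Fin (suc m) → Fin n) (a : Fin k) →
                   ∑ (allVec k m) (λ g → chain u (a ∷ g)) ≡ binom (ι (k ℕ.+ (m ∸ des u) ∸ suc (toℕ a))) m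
    ∑-chain-from {m = zero} u a = trans (+-identityʳ 1#) (sym (trans (*-identityʳ _) invFact-zero))
    ∑-chain-from {k = k} {suc m} u a = begin
      ∑ (allVec k (suc m)) (λ g → chain u (a ∷ g))
        ≡⟨ ∑-product _∷_ (allFin k) (allVec k m) (λ g → chain u (a ∷ g)) ⟩
      ∑ (allFin k) (λ b → ∑ (allVec k m) λ g → ⟦ s ≤? toℕ b ⟧ * chain (u ∘ suc) (b ∷ g))
        ≡⟨ ∑-cong (allFin k) (λ b → trans (∑-*ˡ (allVec k m) ⟦ s ≤? toℕ b ⟧ _)
            (cong (⟦ s ≤? toℕ b ⟧ *_) (∑-chain-from (u ∘ suc) b))) ⟩
      ∑ (allFin k) (λ b → ⟦ s ≤? toℕ b ⟧ * binom (ι (k ℕ.+ (m ∸ d) ∸ suc (toℕ b))) m)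
        ≡⟨ ∑-binom {k} m d s s≤k ⟩
      binom (ι (k ℕ.+ (m ∸ d) ∸ s)) (suc m)
        ≡⟨ cong (λ x → binom (ι x) (suc m)) (shift (u (suc zero) Finₚ.<? u zero)) ⟩
      binom (ι (k ℕ.+ (suc m ∸ des u) ∸ suc (toℕ a))) (suc m) ∎
      where
      open ≡-Reasoning
      s = toℕ a ℕ.+ bit (u (suc zero) Finₚ.<? u zero)
      d = des (u ∘ suc)
      s≤k : s ≤ k
      s≤k = ℕₚ.≤-trans (ℕₚ.+-monoʳ-≤ (toℕ a) (bit≤1 (u (suc zero) Finₚ.<? u zero)))
        (subst (_≤ k) (ℕₚ.+-comm 1 (toℕ a)) (Finₚ.toℕ<n a))
      shift : ∀ {P : Set} (p : Dec P) →
              k ℕ.+ (m ∸ d) ∸ (toℕ a ℕ.+ bit p) ≡ k ℕ.+ (suc m ∸ (bit p ℕ.+ d)) ∸ suc (toℕ a)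
      shift (yes _) = cong (k ℕ.+ (m ∸ d) ∸_) (ℕₚ.+-comm (toℕ a) 1)
      shift (no _)  = trans (cong (k ℕ.+ (m ∸ d) ∸_) (ℕₚ.+-identityʳ (toℕ a)))
        (cong (_∸ suc (toℕ a)) (trans (sym (ℕₚ.+-suc k (m ∸ d)))
            (cong (k ℕ.+_) (sym (ℕₚ.+-∸-assoc 1 (des≤ (u ∘ suc)))))))

    ∑-chain : ∀ (u : Fin (suc m) → Fin n) →
              ∑ (allVec k (suc m)) (chain u) ≡ binom (ι k + ι m - ι (des u)) (suc m)
    ∑-chain {m} {k = k} u = begin
      ∑ (allVec k (suc m)) (chain u)
        ≡⟨ ∑-product _∷_ (allFin k) (allVec k m) (chain u) ⟩
      ∑ (allFin k) (λ a → ∑ (allVec k m) λ g → chain u (a ∷ g))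
        ≡⟨ ∑-cong (allFin k) (λ a → trans (∑-chain-from u a) (sym (*-identityˡ _))) ⟩
      ∑ (allFin k) (λ a → ⟦ 0 ≤? toℕ a ⟧ * binom (ι (k ℕ.+ (m ∸ des u) ∸ suc (toℕ a))) m)
        ≡⟨ ∑-binom {k} m (des u) 0 z≤n ⟩
      binom (ι (k ℕ.+ (m ∸ des u))) (suc m)
        -- By `des≤` the truncated subtraction is a true one, so it agrees with subtraction in the
        -- ring.
        ≡⟨ cong (λ z → binom z (suc m)) (-‿unique (trans (sym (ι-+ (k ℕ.+ (m ∸ des u)) (des u)))
             (trans (cong ι (trans (ℕₚ.+-assoc k _ _) (cong (k ℕ.+_) (ℕₚ.m∸n+n≡m (des≤ u))))) (ι-+ k m)))) ⟨
      binom (ι k + ι m - ι (des u)) (suc m) ∎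
      where open ≡-Reasoning

    -- Reading the labels in the order prescribed by π, that is, passing from f to g = f ∘ π, turns
    -- the condition that π sorts f into a chain condition on g along the word of π.
    Ψ-binom : ∀ k (π : Permutation′ (suc m)) → Ψ k π ≡ binom (ι k + ι m - ι (des (π ⟨$⟩ʳ_))) (suc m)
    Ψ-binom {m} k π = begin
      Ψ k π
        ≡⟨ ∑-permute {k = k} (flip π) (λ f → ⟦ sorts? π f ⟧) ⟨
      ∑ (allVec k (suc m)) (λ g → ⟦ sorts? π (permute (flip π) g) ⟧)
        ≡⟨ ∑-cong (allVec k (suc m)) (λ g → trans
             (⟦⟧-⇔ (sorts? π (permute (flip π) g)) (increasing? (w g)) (increasing-cong (e g))
                 (increasing-cong (sym ∘ e g)))
             (chain-increasing (π ⟨$⟩ʳ_) (injective π) g)) ⟩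
      ∑ (allVec k (suc m)) (chain (π ⟨$⟩ʳ_))
        ≡⟨ ∑-chain {k = k} (π ⟨$⟩ʳ_) ⟩
      binom (ι k + ι m - ι (des (π ⟨$⟩ʳ_))) (suc m) ∎
      where
      open ≡-Reasoning
      w : Vec (Fin k) (suc m) → Fin (suc m) → ℕ
      w g i = toℕ (combine (lookup g i) (π ⟨$⟩ʳ i))
      e : ∀ g i → key (permute (flip π) g) (π ⟨$⟩ʳ i) ≡ w g i
      e g i = cong (λ x → toℕ (combine x (π ⟨$⟩ʳ i))) (trans
          (Vecₚ.lookup∘tabulate (λ j → lookup g (π ⟨$⟩ˡ j)) (π ⟨$⟩ʳ i)) (cong (lookup g) (inverseˡ π)))
      injective : ∀ (σ : Permutation′ (suc m)) {i j} → σ ⟨$⟩ʳ i ≡ σ ⟨$⟩ʳ j → i ≡ j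
      injective σ e = trans (sym (inverseˡ σ)) (trans (cong (σ ⟨$⟩ˡ_) e) (inverseˡ σ))

    -- Cyclic descents

    next : Fin (suc m) → Fin (suc m)
    next {m} i = suc (toℕ i) mod suc m

    toℕ-next : (i : Fin (suc m)) → toℕ (next i) ≡ suc (toℕ i) % suc m
    toℕ-next i = Finₚ.toℕ-fromℕ< _

    next-inject₁ : (i : Fin m) → next (inject₁ i) ≡ suc i
    next-inject₁ {m} i = Finₚ.toℕ-injective (trans (toℕ-next (inject₁ i))
      (trans (cong (λ x → suc x % suc m) (Finₚ.toℕ-inject₁ i)) (m<n⇒m%n≡m (s≤s (Finₚ.toℕ<n i)))))

    next-last : ∀ m → next (Fin.fromℕ m) ≡ zero
    next-last m = Finₚ.toℕ-injective (trans (toℕ-next (Fin.fromℕ m))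
      (trans (cong (λ x → suc x % suc m) (Finₚ.toℕ-fromℕ m)) (n%n≡0 (suc m))))

    prev : Fin (suc m) → Fin (suc m)
    prev {m} zero = Fin.fromℕ m
    prev (suc i)  = inject₁ i

    ω : Permutation′ (suc m)
    ω {m} = permutation next prev next-prev prev-next
      where
      next-prev : ∀ i → next (prev i) ≡ i
      next-prev zero    = next-last m
      next-prev (suc i) = next-inject₁ i
      prev-next : ∀ i → prev (next i) ≡ i
      prev-next i with view i
      ... | ‵fromℕ = cong prev (next-last m)
      ... | ‵inj₁ {i = j} _ = cong prev (next-inject₁ j)

    -- The power ωⁱ. Thus `rot i ∘ₚ π` is πωⁱ, which rotates positions, and `π ∘ₚ rot i` is ωⁱπ,
    -- which rotates values.
    rot : ℕ → Permutation′ (suc m)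
    rot zero    = Perm.id
    rot (suc i) = ω ∘ₚ rot i

    rot-next : ∀ i (s : Fin (suc m)) → rot i ⟨$⟩ʳ next s ≡ next (rot i ⟨$⟩ʳ s)
    rot-next zero    s = refl
    rot-next (suc i) s = rot-next i (next s)

    rot-zero : ∀ i → i ≤ m → toℕ (rot {m} i ⟨$⟩ʳ zero) ≡ i
    rot-zero zero    i≤m = refl
    rot-zero {m} (suc i) i<m = begin
      toℕ (rot {m} i ⟨$⟩ʳ next zero)          ≡⟨ cong toℕ (rot-next i zero) ⟩
      toℕ (next (rot {m} i ⟨$⟩ʳ zero))        ≡⟨ toℕ-next _ ⟩
      suc (toℕ (rot {m} i ⟨$⟩ʳ zero)) % suc m ≡⟨ cong (λ x → suc x % suc m) (rot-zero i (ℕₚ.<⇒≤ i<m)) ⟩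
      suc i % suc m                           ≡⟨ m<n⇒m%n≡m (s≤s i<m) ⟩
      suc i                                   ∎
      where open ≡-Reasoning

    -- The word of πωⁱ starts at position i of π and ends at `prev i`. Hence the one cyclic
    -- comparison of π that the ordinary descents of πωⁱ omit is the one at `prev i`.
    rot-last : (i : Fin (suc m)) → rot (toℕ i) ⟨$⟩ʳ Fin.fromℕ m ≡ prev i
    rot-last {m} i = begin
      r ⟨$⟩ʳ Fin.fromℕ m               ≡⟨ inverseˡ ω ⟨
      prev (next (r ⟨$⟩ʳ Fin.fromℕ m)) ≡⟨ cong prev (rot-next (toℕ i) (Fin.fromℕ m)) ⟨
      prev (r ⟨$⟩ʳ next (Fin.fromℕ m)) ≡⟨ cong (λ s → prev (r ⟨$⟩ʳ s)) (next-last m) ⟩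
      prev (r ⟨$⟩ʳ zero)           ≡⟨ cong prev (Finₚ.toℕ-injective
          (rot-zero (toℕ i) (ℕₚ.≤-pred (Finₚ.toℕ<n i)))) ⟩
      prev i                       ∎
      where
      open ≡-Reasoning
      r = rot {m} (toℕ i)

    ∑-allFin-last : ∀ n (f : Fin (suc n) → K) →
                    ∑ (allFin (suc n)) f ≡ ∑ (allFin n) (f ∘ inject₁) + f (Fin.fromℕ n)
    ∑-allFin-last zero    f = trans (+-identityʳ _) (sym (+-identityˡ _))
    ∑-allFin-last (suc n) f = begin
      ∑ (allFin (suc (suc n))) f
        ≡⟨ ∑-allFin-suc (suc n) f ⟩
      f zero + ∑ (allFin (suc n)) (f ∘ suc)
        ≡⟨ cong (f zero +_) (∑-allFin-last n (f ∘ suc)) ⟩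
      f zero + (∑ (allFin n) (f ∘ suc ∘ inject₁) + f (Fin.fromℕ (suc n)))
        ≡⟨ +-assoc _ _ _ ⟨
      f zero + ∑ (allFin n) (f ∘ suc ∘ inject₁) + f (Fin.fromℕ (suc n))
        ≡⟨ cong (_+ f (Fin.fromℕ (suc n))) (∑-allFin-suc n (f ∘ inject₁)) ⟨
      ∑ (allFin (suc n)) (f ∘ inject₁) + f (Fin.fromℕ (suc n)) ∎
      where open ≡-Reasoning

    ∑-rotate : ∀ (π : Permutation′ n) (f : Fin n → K) → ∑ (allFin n) (λ i → f (π ⟨$⟩ʳ i)) ≡ ∑ (allFin n) f
    ∑-rotate {n} π f = ∑-reindex (fins n) (fins n) (π ⟨$⟩ʳ_) (π ⟨$⟩ˡ_)
      (λ e → trans (sym (inverseˡ π)) (cong (π ⟨$⟩ˡ_) e)) (λ e → trans (cong (π ⟨$⟩ʳ_) e) (inverseʳ π)) f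
          (cong f)

    ι-bit : ∀ {P : Set} (d : Dec P) → ι (bit d) ≡ ⟦ d ⟧
    ι-bit (yes _) = +-identityʳ 1#
    ι-bit (no _)  = refl

    ι-length-filter : ∀ {P : Pred A _} (P? : Decidable₁ P) xs →
                      ι (length (filter P? xs)) ≡ ∑ xs (λ x → ⟦ P? x ⟧)
    ι-length-filter P? []       = refl
    ι-length-filter P? (x ∷ xs) with P? x
    ... | yes _ = cong (1# +_) (ι-length-filter P? xs)
    ... | no _  = trans (ι-length-filter P? xs) (sym (+-identityˡ _))

    ι-cdes : (π : Permutation′ (suc m)) → ι (cdes π) ≡ ∑ (allFin (suc m)) (λ i → ⟦ cyclicDescent? π i ⟧)
    ι-cdes {m} π = ι-length-filter (cyclicDescent? π) (allFin (suc m))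

    ι-des : (u : Fin (suc m) → Fin n) → ι (des u) ≡ ∑ (allFin m) (λ i → ⟦ u (suc i) Finₚ.<? u (inject₁ i) ⟧)
    ι-des {zero}  u = refl
    ι-des {suc m} u = begin
      ι (bit d ℕ.+ des (u ∘ suc))       ≡⟨ ι-+ (bit d) _ ⟩
      ι (bit d) + ι (des (u ∘ suc))     ≡⟨ cong₂ _+_ (ι-bit d) (ι-des (u ∘ suc)) ⟩
      ⟦ d ⟧ + ∑ (allFin m) (λ i → ⟦ u (suc (suc i)) Finₚ.<? u (suc (inject₁ i)) ⟧)
        ≡⟨ ∑-allFin-suc m (λ i → ⟦ u (suc i) Finₚ.<? u (inject₁ i) ⟧) ⟨
      ∑ (allFin (suc m)) (λ i → ⟦ u (suc i) Finₚ.<? u (inject₁ i) ⟧) ∎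
      where
      open ≡-Reasoning
      d = u (suc zero) Finₚ.<? u zero

    cdes-des : (π : Permutation′ (suc m)) → ι (cdes π) ≡ ι (des (π ⟨$⟩ʳ_)) + ⟦ cyclicDescent? π (Fin.fromℕ m) ⟧
    cdes-des {m} π = begin
      ι (cdes π)
        ≡⟨ ι-cdes π ⟩
      ∑ (allFin (suc m)) (λ i → ⟦ cyclicDescent? π i ⟧)
        ≡⟨ ∑-allFin-last m _ ⟩
      ∑ (allFin m) (λ i → ⟦ cyclicDescent? π (inject₁ i) ⟧) + ⟦ cyclicDescent? π (Fin.fromℕ m) ⟧
        ≡⟨ cong (_+ _) (∑-cong (allFin m) λ i → cong (λ j → ⟦ (π ⟨$⟩ʳ j) Finₚ.<? (π ⟨$⟩ʳ inject₁ i) ⟧)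
            (next-inject₁ i)) ⟩
      ∑ (allFin m) (λ i → ⟦ (π ⟨$⟩ʳ suc i) Finₚ.<? (π ⟨$⟩ʳ inject₁ i) ⟧) + ⟦ cyclicDescent? π (Fin.fromℕ m) ⟧
        ≡⟨ cong (_+ ⟦ cyclicDescent? π (Fin.fromℕ m) ⟧) (ι-des (π ⟨$⟩ʳ_)) ⟨
      ι (des (π ⟨$⟩ʳ_)) + ⟦ cyclicDescent? π (Fin.fromℕ m) ⟧ ∎
      where open ≡-Reasoning

    cyclicDescent-rot : ∀ i (π : Permutation′ (suc m)) s →
                        ⟦ cyclicDescent? (rot i ∘ₚ π) s ⟧ ≡ ⟦ cyclicDescent? π (rot i ⟨$⟩ʳ s) ⟧
    cyclicDescent-rot i π s = cong (λ j → ⟦ (π ⟨$⟩ʳ j) Finₚ.<? (π ⟨$⟩ʳ (rot i ⟨$⟩ʳ s)) ⟧) (rot-next i s)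

    cdes-rotˡ : ∀ i (π : Permutation′ (suc m)) → ι (cdes (rot i ∘ₚ π)) ≡ ι (cdes π)
    cdes-rotˡ {m} i π = trans (ι-cdes (rot i ∘ₚ π)) (trans (∑-cong (allFin (suc m)) (cyclicDescent-rot i π))
      (trans (∑-rotate (rot i) (λ s → ⟦ cyclicDescent? π s ⟧)) (sym (ι-cdes π))))

    -- ω makes the largest value the smallest, so the cyclic descent right after it becomes
    -- one right before it.
    next-< : ∀ (v w : Fin (suc m)) → ⟦ next w Finₚ.<? next v ⟧ + ⟦ v Finₚ.≟ Fin.fromℕ m ⟧ ≡ ⟦ w Finₚ.<? v ⟧ + ⟦ w Finₚ.≟ Fin.fromℕ m ⟧
    next-< {m} v w with view v | view w
    ... | ‵fromℕ | ‵fromℕ rewrite next-last m = cong (_+ ⟦ Fin.fromℕ m Finₚ.≟ Fin.fromℕ m ⟧)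
      (sym (⟦⟧-no (Fin.fromℕ m Finₚ.<? Fin.fromℕ m) (ℕₚ.<-irrefl refl)))
    ... | ‵fromℕ | ‵inj₁ {i = j} _ rewrite next-last m = trans
        (cong (0# +_) (⟦⟧-yes (Fin.fromℕ m Finₚ.≟ Fin.fromℕ m) refl))
      (trans (+-comm 0# 1#) (sym (cong₂ _+_
        (⟦⟧-yes (inject₁ j Finₚ.<? Fin.fromℕ m) (subst₂ _<_ (sym (Finₚ.toℕ-inject₁ j))
            (sym (Finₚ.toℕ-fromℕ m)) (Finₚ.toℕ<n j)))
        (⟦⟧-no (inject₁ j Finₚ.≟ Fin.fromℕ m) (Finₚ.fromℕ≢inject₁ ∘ sym)))))
    ... | ‵inj₁ {i = i} _ | ‵fromℕ rewrite next-last m | next-inject₁ i = trans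
      (cong (1# +_) (⟦⟧-no (inject₁ i Finₚ.≟ Fin.fromℕ m) (Finₚ.fromℕ≢inject₁ ∘ sym)))
      (trans (+-comm 1# 0#) (sym (cong₂ _+_
        (⟦⟧-no (Fin.fromℕ m Finₚ.<? inject₁ i) λ lt → ℕₚ.<-asym
            (subst₂ _<_ (Finₚ.toℕ-fromℕ m) (Finₚ.toℕ-inject₁ i) lt) (Finₚ.toℕ<n i))
        (⟦⟧-yes (Fin.fromℕ m Finₚ.≟ Fin.fromℕ m) refl))))
    ... | ‵inj₁ {i = i} _ | ‵inj₁ {i = j} _ rewrite next-inject₁ i | next-inject₁ j = cong₂ _+_
      (⟦⟧-⇔ (suc j Finₚ.<? suc i) (inject₁ j Finₚ.<? inject₁ i)
        (λ { (s≤s lt) → subst₂ _<_ (sym (Finₚ.toℕ-inject₁ j)) (sym (Finₚ.toℕ-inject₁ i)) lt })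
        (λ lt → s≤s (subst₂ _<_ (Finₚ.toℕ-inject₁ j) (Finₚ.toℕ-inject₁ i) lt)))
      (trans (⟦⟧-no (inject₁ i Finₚ.≟ Fin.fromℕ m) (Finₚ.fromℕ≢inject₁ ∘ sym))
        (sym (⟦⟧-no (inject₁ j Finₚ.≟ Fin.fromℕ m) (Finₚ.fromℕ≢inject₁ ∘ sym))))

    -- The two corrections in `next-<` mark the largest value at position i and at the position
    -- after i. Summed around the cycle they agree, so they cancel.
    cdes-ω : (π : Permutation′ (suc m)) → ι (cdes (π ∘ₚ ω)) ≡ ι (cdes π)
    cdes-ω {m} π = +-cancelʳ lasts (begin
      ι (cdes (π ∘ₚ ω)) + lasts
        ≡⟨ cong (_+ lasts) (ι-cdes (π ∘ₚ ω)) ⟩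
      ∑ (allFin (suc m)) (λ i → ⟦ cyclicDescent? (π ∘ₚ ω) i ⟧) + lasts
        ≡⟨ ∑-+ (allFin (suc m)) _ _ ⟨
      ∑ (allFin (suc m)) (λ i → ⟦ cyclicDescent? (π ∘ₚ ω) i ⟧ + ⟦ π ⟨$⟩ʳ i Finₚ.≟ Fin.fromℕ m ⟧)
        ≡⟨ ∑-cong (allFin (suc m)) (λ i → next-< (π ⟨$⟩ʳ i) (π ⟨$⟩ʳ next i)) ⟩
      ∑ (allFin (suc m)) (λ i → ⟦ cyclicDescent? π i ⟧ + ⟦ π ⟨$⟩ʳ next i Finₚ.≟ Fin.fromℕ m ⟧)
        ≡⟨ ∑-+ (allFin (suc m)) _ _ ⟩
      ∑ (allFin (suc m)) (λ i → ⟦ cyclicDescent? π i ⟧) +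
      ∑ (allFin (suc m)) (λ i → ⟦ π ⟨$⟩ʳ next i Finₚ.≟ Fin.fromℕ m ⟧)
        ≡⟨ cong₂ _+_ (sym (ι-cdes π)) (∑-rotate ω (λ i → ⟦ π ⟨$⟩ʳ i Finₚ.≟ Fin.fromℕ m ⟧)) ⟩
      ι (cdes π) + lasts ∎)
      where
      open ≡-Reasoning
      lasts = ∑ (allFin (suc m)) (λ i → ⟦ π ⟨$⟩ʳ i Finₚ.≟ Fin.fromℕ m ⟧)

    cdes-cong : {σ τ : Permutation′ (suc m)} → σ ≈ₚ τ → ι (cdes σ) ≡ ι (cdes τ)
    cdes-cong {m} {σ} {τ} e = trans (ι-cdes σ) (trans
      (∑-cong (allFin (suc m)) λ i → cong₂ (λ v w → ⟦ w Finₚ.<? v ⟧) (e i) (e (next i))) (sym (ι-cdes τ)))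

    cdes-rotʳ : ∀ i (π : Permutation′ (suc m)) → ι (cdes (π ∘ₚ rot i)) ≡ ι (cdes π)
    cdes-rotʳ zero    π = cdes-cong {σ = π ∘ₚ Perm.id} {π} λ _ → refl
    cdes-rotʳ (suc i) π = trans (cdes-cong {σ = π ∘ₚ rot (suc i)} {(π ∘ₚ ω) ∘ₚ rot i} λ _ → refl)
      (trans (cdes-rotʳ i (π ∘ₚ ω)) (cdes-ω π))

    -- The value at x = k of the binomial coefficient of π in φ(x).
    Φ : ℕ → Permutation′ (suc m) → K
    Φ {m} k π = binom (ι k + ι m - ι (cdes π)) m

    Φ-cong : ∀ k {σ τ : Permutation′ (suc m)} → σ ≈ₚ τ → Φ k σ ≡ Φ k τ
    Φ-cong {m} k {σ} {τ} e = cong (λ c → binom (ι k + ι m - c) m) (cdes-cong {σ = σ} {τ} e)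

    Φ-flip-rotʳ : ∀ k i (π : Permutation′ (suc m)) → Φ k (π ∘ₚ flip (rot i)) ≡ Φ k π
    Φ-flip-rotʳ {m} k i π = cong (λ c → binom (ι k + ι m - c) m) (trans (sym (cdes-rotʳ i (π ∘ₚ flip (rot i))))
      (cdes-cong {σ = (π ∘ₚ flip (rot i)) ∘ₚ rot i} {π} λ _ → inverseʳ (rot i)))

    -- With N = k + m - cdes π, the rotation that hides a cyclic descent counts binom(N + 1, m + 1)
    -- and any other binom(N, m + 1). The total is (m + 1) binom(N, m + 1) + cdes π binom(N, m),
    -- which by `absorb` equals (N - m + cdes π) binom(N, m) = k binom(N, m).
    ∑-rot-Ψ : ∀ k (π : Permutation′ (suc m)) →
              ∑ (allFin (suc m)) (λ i → Ψ k (rot (toℕ i) ∘ₚ π)) ≡ ι k * Φ k π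
    ∑-rot-Ψ {m} k π = begin
      ∑ (allFin (suc m)) (λ i → Ψ k (rot (toℕ i) ∘ₚ π))
        ≡⟨ ∑-cong (allFin (suc m)) term ⟩
      ∑ (allFin (suc m)) (λ i → binom N (suc m) + ⟦ cyclicDescent? π (prev i) ⟧ * binom N m)
        ≡⟨ ∑-+ (allFin (suc m)) _ _ ⟩
      ∑ (allFin (suc m)) (λ i → binom N (suc m)) +
      ∑ (allFin (suc m)) (λ i → ⟦ cyclicDescent? π (prev i) ⟧ * binom N m)
        ≡⟨ cong₂ _+_ (∑-const (suc m) _) (trans (∑-*ʳ (allFin (suc m)) (binom N m) _)
             (cong (_* binom N m) (trans (∑-rotate (flip ω) (λ i → ⟦ cyclicDescent? π i ⟧))
                 (sym (ι-cdes π))))) ⟩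
      ι (suc m) * binom N (suc m) + ι c * binom N m
        ≡⟨ cong (_+ ι c * binom N m) (absorb N m) ⟨
      (N - ι m) * binom N m + ι c * binom N m
        ≡⟨ distribʳ _ _ _ ⟨
      (N - ι m + ι c) * binom N m
        ≡⟨ cong (_* binom N m) N-m+c ⟩
      ι k * Φ k π ∎
      where
      open ≡-Reasoning
      c = cdes π
      N = ι k + ι m - ι c
      N-m+c : N - ι m + ι c ≡ ι k
      N-m+c = +-cancelʳ (ι m) (trans (solve 3 (λ d c m → d :+ c :+ m := d :+ m :+ c) refl (N - ι m) (ι c) (ι m))
        (trans (cong (_+ ι c) (x-y+y N (ι m))) (x-y+y (ι k + ι m) (ι c))))
      add-bit : ∀ {P : Set} (d : Dec P) → binom (N + ⟦ d ⟧) (suc m) ≡ binom N (suc m) + ⟦ d ⟧ * binom N m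
      add-bit (yes _) = trans (cong (λ z → binom z (suc m)) (+-comm N 1#))
        (trans (pascal N m) (cong (binom N (suc m) +_) (sym (*-identityˡ _))))
      add-bit (no _)  = trans (cong (λ z → binom z (suc m)) (+-identityʳ N))
        (sym (trans (cong (binom N (suc m) +_) (zeroˡ _)) (+-identityʳ _)))
      term : ∀ i → Ψ k (rot (toℕ i) ∘ₚ π) ≡ binom N (suc m) + ⟦ cyclicDescent? π (prev i) ⟧ * binom N m
      term i = begin
        Ψ k π′
          ≡⟨ Ψ-binom k π′ ⟩
        binom (ι k + ι m - ι (des (π′ ⟨$⟩ʳ_))) (suc m)
          ≡⟨ cong (λ z → binom z (suc m)) (-‿unique
               (trans (solve 3 (λ N e d → N :+ e :+ d := N :+ (d :+ e)) refl N ⟦ e? ⟧ (ι (des (π′ ⟨$⟩ʳ_))))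
                 (trans (cong (N +_) (sym c≡)) (x-y+y (ι k + ι m) (ι c))))) ⟩
        binom (N + ⟦ e? ⟧) (suc m)
          ≡⟨ add-bit e? ⟩
        binom N (suc m) + ⟦ e? ⟧ * binom N m ∎
        where
        π′ = rot (toℕ i) ∘ₚ π
        e? = cyclicDescent? π (prev i)
        c≡ : ι c ≡ ι (des (π′ ⟨$⟩ʳ_)) + ⟦ e? ⟧
        c≡ = trans (sym (cdes-rotˡ (toℕ i) π)) (trans (cdes-des π′) (cong (ι (des (π′ ⟨$⟩ʳ_)) +_)
          (trans (cyclicDescent-rot (toℕ i) π (Fin.fromℕ m))
              (cong (λ s → ⟦ cyclicDescent? π s ⟧) (rot-last i)))))

    Φ-convolution : ∀ k l (ρ : Permutation′ (suc m)) →
                    ∑ (permutations (suc m)) (λ σ → Φ (suc k) σ * Φ (suc l) (ρ ∘ₚ flip σ)) ≡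
                    ι (suc m) * Φ (suc l ℕ.* suc k) ρ
    Φ-convolution {m} k l ρ = ι-cancel k (ι-cancel l (begin
      ι l⁺ * (ι k⁺ * ∑ Sₙ (λ σ → Φ k⁺ σ * Φ l⁺ (ρ ∘ₚ flip σ)))
        ≡⟨ trans (∑-*ˡ Sₙ (ι l⁺) _) (cong (ι l⁺ *_) (∑-*ˡ Sₙ (ι k⁺) _)) ⟨
      ∑ Sₙ (λ σ → ι l⁺ * (ι k⁺ * (Φ k⁺ σ * Φ l⁺ (ρ ∘ₚ flip σ))))
        ≡⟨ ∑-cong Sₙ (λ σ → trans
             (solve 4 (λ l k a b → l :* (k :* (a :* b)) := (k :* a) :* (l :* b)) refl (ι l⁺) (ι k⁺)
                 (Φ k⁺ σ) (Φ l⁺ (ρ ∘ₚ flip σ)))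
             (trans (cong (_* (ι l⁺ * Φ l⁺ (ρ ∘ₚ flip σ))) (sym (∑-rot-Ψ k⁺ σ))) (sym (∑-*ʳ Zₙ _ _)))) ⟩
      ∑ Sₙ (λ σ → ∑ Zₙ λ i → Ψ k⁺ (rot (toℕ i) ∘ₚ σ) * (ι l⁺ * Φ l⁺ (ρ ∘ₚ flip σ)))
        ≡⟨ ∑-swap Sₙ Zₙ _ ⟩
      ∑ Zₙ (λ i → ∑ Sₙ λ σ → Ψ k⁺ (rot (toℕ i) ∘ₚ σ) * (ι l⁺ * Φ l⁺ (ρ ∘ₚ flip σ)))
        ≡⟨ ∑-cong Zₙ (λ i → ∑-unrotate (toℕ i)) ⟩
      ∑ Zₙ (λ i → ∑ Sₙ G)
        ≡⟨ ∑-const (suc m) _ ⟩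
      ι (suc m) * ∑ Sₙ G
        ≡⟨ cong (ι (suc m) *_) (∑-cong Sₙ λ σ → trans (cong (Ψ k⁺ σ *_) (sym (∑-rot-Ψ l⁺ (ρ ∘ₚ flip σ))))
            (sym (∑-*ˡ Zₙ _ _))) ⟩
      ι (suc m) * ∑ Sₙ (λ σ → ∑ Zₙ λ i → Ψ k⁺ σ * Ψ l⁺ (rot (toℕ i) ∘ₚ (ρ ∘ₚ flip σ)))
        ≡⟨ cong (ι (suc m) *_) (trans (∑-swap Sₙ Zₙ _) (∑-cong Zₙ λ i → trans
             (∑-cong Sₙ λ σ → cong (Ψ k⁺ σ *_)
               (Ψ-cong l⁺ {rot (toℕ i) ∘ₚ (ρ ∘ₚ flip σ)} {(rot (toℕ i) ∘ₚ ρ) ∘ₚ flip σ} λ _ → refl))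
             (Ψ-convolution k⁺ l⁺ (rot (toℕ i) ∘ₚ ρ)))) ⟩
      ι (suc m) * ∑ Zₙ (λ i → Ψ (l⁺ ℕ.* k⁺) (rot (toℕ i) ∘ₚ ρ))
        ≡⟨ cong (ι (suc m) *_) (trans (∑-rot-Ψ (l⁺ ℕ.* k⁺) ρ) (cong (_* Φ (l⁺ ℕ.* k⁺) ρ) (ι-* l⁺ k⁺))) ⟩
      ι (suc m) * (ι l⁺ * ι k⁺ * Φ (l⁺ ℕ.* k⁺) ρ)
        ≡⟨ solve 4 (λ n l k a → n :* (l :* k :* a) := l :* (k :* (n :* a))) refl (ι (suc m)) (ι l⁺) (ι k⁺)
            (Φ (l⁺ ℕ.* k⁺) ρ) ⟩
      ι l⁺ * (ι k⁺ * (ι (suc m) * Φ (l⁺ ℕ.* k⁺) ρ)) ∎))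
      where
      open ≡-Reasoning
      k⁺ = suc k
      l⁺ = suc l
      Sₙ = permutations (suc m)
      Zₙ = allFin (suc m)
      G : Permutation′ (suc m) → K
      G σ = Ψ k⁺ σ * (ι l⁺ * Φ l⁺ (ρ ∘ₚ flip σ))
      G-cong : ∀ {σ τ} → σ ≈ₚ τ → G σ ≡ G τ
      G-cong {σ} {τ} e = cong₂ (λ x y → x * (ι l⁺ * y)) (Ψ-cong k⁺ {σ} {τ} e)
        (Φ-cong l⁺ {ρ ∘ₚ flip σ} {ρ ∘ₚ flip τ} λ i → flip-cong (ρ ⟨$⟩ʳ i))
        where
        flip-cong : ∀ i → σ ⟨$⟩ˡ i ≡ τ ⟨$⟩ˡ i
        flip-cong i = trans (sym (inverseˡ τ)) (cong (τ ⟨$⟩ˡ_) (trans (sym (e (σ ⟨$⟩ˡ i))) (inverseʳ σ)))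
      -- Invariance under rotation of values gives Φ(σ⁻¹ρ) = Φ(ω⁻ⁱσ⁻¹ρ) = Φ((σωⁱ)⁻¹ρ). The summand
      -- is thus `G` at σωⁱ, and σ ↦ σωⁱ permutes the group.
      ∑-unrotate : ∀ i → ∑ Sₙ (λ σ → Ψ k⁺ (rot i ∘ₚ σ) * (ι l⁺ * Φ l⁺ (ρ ∘ₚ flip σ))) ≡ ∑ Sₙ G
      ∑-unrotate i = trans
        (∑-cong Sₙ λ σ → cong (λ x → Ψ k⁺ (rot i ∘ₚ σ) * (ι l⁺ * x))
            (trans (sym (Φ-flip-rotʳ l⁺ i (ρ ∘ₚ flip σ)))
          (Φ-cong l⁺ {(ρ ∘ₚ flip σ) ∘ₚ flip (rot i)} {ρ ∘ₚ flip (rot i ∘ₚ σ)} λ _ → refl)))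
        (∑-reindex (perms (suc m)) (perms (suc m)) (rot i ∘ₚ_) (flip (rot i) ∘ₚ_)
          (λ {σ} e j → trans (cong (σ ⟨$⟩ʳ_) (sym (inverseʳ (rot i)))) (e (rot i ⟨$⟩ˡ j)))
          (λ {σ} {τ} e j → trans (e (rot i ⟨$⟩ʳ j)) (cong (τ ⟨$⟩ʳ_) (inverseˡ (rot i))))
          G (λ {σ} {τ} → G-cong {σ} {τ}))

    -- Polynomials are determined by their values at positive integers

    pow : K → ℕ → K
    pow x zero    = 1#
    pow x (suc i) = x * pow x i

    pow-* : ∀ x y i → pow (x * y) i ≡ pow x i * pow y i
    pow-* x y zero    = sym (*-identityˡ 1#)
    pow-* x y (suc i) = trans (cong (x * y *_) (pow-* x y i))
      (solve 4 (λ x y p q → x :* y :* (p :* q) := x :* p :* (y :* q)) refl x y (pow x i) (pow y i))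

    pow-+ : ∀ x i j → pow x (i ℕ.+ j) ≡ pow x i * pow x j
    pow-+ x zero    j = sym (*-identityˡ _)
    pow-+ x (suc i) j = trans (cong (x *_) (pow-+ x i j)) (sym (*-assoc x (pow x i) (pow x j)))

    -- A polynomial Σ cᵢ xⁱ is viewed as the functional h ↦ Σ cᵢ h(i) on functions ℕ → K;
    -- its value at x is the value of the functional at the powers of x.
    record Functional (d : ℕ) (D : (ℕ → K) → K) : Set where
      field
        additive    : ∀ g h → D (λ i → g i + h i) ≡ D g + D h
        homogeneous : ∀ c h → D (λ i → c * h i) ≡ c * D h
        local       : ∀ {g h} → (∀ i → i < d → g i ≡ h i) → D g ≡ D h

    module _ (a : K) where

      -- acc h i = Σ_{j<i} a^(i-1-j) h(j), so that (x - a) acc (pow x) i = xⁱ - aⁱ.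
      acc : (ℕ → K) → ℕ → K
      acc h zero    = 0#
      acc h (suc i) = a * acc h i + h i

      acc-local : ∀ {d g h} → (∀ i → i < d → g i ≡ h i) → ∀ i → i < suc d → acc g i ≡ acc h i
      acc-local e zero    _         = refl
      acc-local e (suc i) (s≤s i<d) = cong₂ (λ x y → a * x + y) (acc-local e i (ℕₚ.m<n⇒m<1+n i<d)) (e i i<d)

      acc-additive : ∀ (g h : ℕ → K) i → acc (λ i → g i + h i) i ≡ acc g i + acc h i
      acc-additive g h zero    = sym (+-identityˡ 0#)
      acc-additive g h (suc i) = trans (cong (λ x → a * x + (g i + h i)) (acc-additive g h i))
        (solve 5 (λ a x y g h → a :* (x :+ y) :+ (g :+ h) := (a :* x :+ g) :+ (a :* y :+ h)) refl a
            (acc g i) (acc h i) (g i) (h i))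

      acc-homogeneous : ∀ c (h : ℕ → K) i → acc (λ i → c * h i) i ≡ c * acc h i
      acc-homogeneous c h zero    = sym (zeroʳ c)
      acc-homogeneous c h (suc i) = trans (cong (λ x → a * x + c * h i) (acc-homogeneous c h i))
        (solve 4 (λ a c x h → a :* (c :* x) :+ c :* h := c :* (a :* x :+ h)) refl a c (acc h i) (h i))

      acc-pow : ∀ w i → w * acc (pow (w + a)) i + pow a i ≡ pow (w + a) i
      acc-pow w zero    = trans (cong (_+ 1#) (zeroʳ w)) (+-identityˡ 1#)
      acc-pow w (suc i) = trans
        (solve 5 (λ w a x p q → w :* (a :* x :+ p) :+ a :* q := a :* (w :* x :+ q) :+ w :* p) refl w a
            (acc (pow (w + a)) i) (pow (w + a) i) (pow a i))
        (trans (cong (λ x → a * x + w * pow (w + a) i) (acc-pow w i))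
          (solve 3 (λ w a p → a :* p :+ w :* p := (w :+ a) :* p) refl w a (pow (w + a) i)))

      acc-surjective : ∀ (h : ℕ → K) i → acc (λ j → h (suc j) - a * h j) i + h 0 * pow a i ≡ h i
      acc-surjective h zero    = trans (+-identityˡ _) (*-identityʳ _)
      acc-surjective h (suc i) = trans
        (solve 5 (λ a x d c p → a :* x :+ d :+ c :* (a :* p) := d :+ a :* (x :+ c :* p)) refl a
            (acc (λ j → h (suc j) - a * h j) i) (h (suc i) - a * h i) (h 0) (pow a i))
        (trans (cong (λ x → h (suc i) - a * h i + a * x) (acc-surjective h i)) (x-y+y (h (suc i)) (a * h i)))

      -- `acc h i` involves only the values of h below i, so dividing by x - a lowers the degree
      -- bound by one.
      quotient : ∀ {d D} → Functional (suc d) D → Functional d (D ∘ acc)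
      quotient F = record
        { additive    = λ g h → trans (local λ i _ → acc-additive g h i) (additive (acc g) (acc h))
        ; homogeneous = λ c h → trans (local λ i _ → acc-homogeneous c h i) (homogeneous c (acc h))
        ; local       = λ e → local (acc-local e)
        }
        where open Functional F

    -- Divide by x - N, where N is a root. The quotient vanishes at every k > N because k - N can be
    -- cancelled, so the induction continues with the roots from N + 1 on. By `acc-surjective` every
    -- h is a value of `acc` plus a multiple of the powers of N, and D kills both. For d = 0 the
    -- functional ignores its argument, hence is 0 by homogeneity.
    functional-vanish : ∀ d {D} N → Functional d D → (∀ k → N ≤ k → D (pow (ι k)) ≡ 0#) → ∀ h → D h ≡ 0#
    functional-vanish zero N F e h = trans (local {h = λ i → 0# * h i} λ _ ())
        (trans (homogeneous 0# h) (zeroˡ _))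
      where open Functional F
    functional-vanish (suc d) {D} N F e h = begin
      D h                                        ≡⟨ local (λ i _ → sym (acc-surjective a h i)) ⟩
      D (λ i → acc a h′ i + h 0 * pow a i)       ≡⟨ additive _ _ ⟩
      D (acc a h′) + D (λ i → h 0 * pow a i)
        ≡⟨ cong₂ _+_ (functional-vanish d (suc N) (quotient a F) quotient-vanish h′)
             (trans (homogeneous (h 0) (pow a)) (trans (cong (h 0 *_) (e N ℕₚ.≤-refl)) (zeroʳ _))) ⟩
      0# + 0#                                    ≡⟨ +-identityˡ 0# ⟩
      0#                                         ∎
      where
      open ≡-Reasoning
      open Functional F
      a = ι N
      h′ : ℕ → K
      h′ j = h (suc j) - a * h j
      quotient-vanish : ∀ k → suc N ≤ k → D (acc a (pow (ι k))) ≡ 0#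
      quotient-vanish k N<k = ι-cancel t (begin
        w * D (acc a (pow (ι k)))                              ≡⟨ +-identityʳ _ ⟨
        w * D (acc a (pow (ι k))) + 0#                         ≡⟨ cong₂ _+_
            (homogeneous w (acc a (pow (ι k)))) (e N ℕₚ.≤-refl) ⟨
        D (λ i → w * acc a (pow (ι k)) i) + D (pow a)          ≡⟨ additive _ _ ⟨
        D (λ i → w * acc a (pow (ι k)) i + pow a i)            ≡⟨ local
            (λ i _ → subst (λ x → w * acc a (pow x) i + pow a i ≡ pow x i) k≡ (acc-pow a w i)) ⟩
        D (pow (ι k))                                          ≡⟨ e k (ℕₚ.<⇒≤ N<k) ⟩
        0#                                                     ≡⟨ zeroʳ w ⟨
        w * 0#                                                 ∎)
        where
        t = k ∸ suc N
        w = ι (suc t)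
        k≡ : w + a ≡ ι k
        k≡ = trans (sym (ι-+ (suc t) N)) (cong ι (trans (sym (ℕₚ.+-suc t N)) (ℕₚ.m∸n+n≡m N<k)))

    record Polynomial (D : (ℕ → K) → K) : Set where
      field
        degree     : ℕ
        functional : Functional degree D
      open Functional functional public

    open Polynomial

    zero-polynomial : Polynomial (λ _ → 0#)
    zero-polynomial = record
      { degree = 0
      ; functional = record
        { additive    = λ _ _ → sym (+-identityˡ 0#)
        ; homogeneous = λ c _ → sym (zeroʳ c)
        ; local       = λ _ → refl
        } }

    +-polynomial : ∀ {D E} → Polynomial D → Polynomial E → Polynomial (λ h → D h + E h)
    +-polynomial p q = record
      { degree = degree p ℕ.⊔ degree q
      ; functional = record
        { additive    = λ g h → trans (cong₂ _+_ (additive p g h) (additive q g h)) (interchange _ _ _ _)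
        ; homogeneous = λ c h → trans (cong₂ _+_ (homogeneous p c h) (homogeneous q c h)) (sym (distribˡ c _ _))
        ; local       = λ e → cong₂ _+_ (local p λ i i< → e i (ℕₚ.<-≤-trans i< (ℕₚ.m≤m⊔n _ _)))
                                        (local q λ i i< → e i (ℕₚ.<-≤-trans i< (ℕₚ.m≤n⊔m (degree p) _)))
        } }

    *-polynomial : ∀ {D} b → Polynomial D → Polynomial (λ h → b * D h)
    *-polynomial {D} b p = record
      { degree = degree p
      ; functional = record
        { additive    = λ g h → trans (cong (b *_) (additive p g h)) (distribˡ b _ _)
        ; homogeneous = λ c h → trans (cong (b *_) (homogeneous p c h))
            (solve 3 (λ b c x → b :* (c :* x) := c :* (b :* x)) refl b c (D h))
        ; local       = λ e → cong (b *_) (local p e)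
        } }

    -- With w the powers of a number y, this is the substitution of xy for x.
    weighted-polynomial : ∀ {D} (w : ℕ → K) → Polynomial D → Polynomial (λ h → D (λ i → w i * h i))
    weighted-polynomial w p = record
      { degree = degree p
      ; functional = record
        { additive    = λ g h → trans (local p λ i _ → distribˡ (w i) (g i) (h i)) (additive p _ _)
        ; homogeneous = λ c h → trans (local p λ i _ → solve 3
            (λ b c x → b :* (c :* x) := c :* (b :* x)) refl (w i) c (h i)) (homogeneous p c _)
        ; local       = λ e → local p λ i i< → cong (w i *_) (e i i<)
        } }

    monomial : ∀ i → Polynomial (λ h → h i)
    monomial i = record
      { degree = suc i
      ; functional = record
        { additive    = λ _ _ → refl
        ; homogeneous = λ _ _ → refl
        ; local       = λ e → e i ℕₚ.≤-refl
        } }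

    ∑-polynomial : ∀ (xs : List A) {D : A → (ℕ → K) → K} → (∀ x → Polynomial (D x)) →
                   Polynomial (λ h → ∑ xs λ x → D x h)
    ∑-polynomial []       p = zero-polynomial
    ∑-polynomial (x ∷ xs) p = +-polynomial (p x) (∑-polynomial xs p)

    polynomial-ext : ∀ {D E} → Polynomial D → Polynomial E →
                     (∀ k → D (pow (ι (suc k))) ≡ E (pow (ι (suc k)))) → ∀ h → D h ≡ E h
    polynomial-ext {D} {E} p q e h = trans (sym (+-identityʳ _)) (trans (cong (D h +_) (sym (cancel (E h))))
      (trans (sym (+-assoc (D h) _ _)) (trans (cong (_+ E h)
        (functional-vanish (degree diff) 1 (functional diff)
            (λ { (suc k) _ → trans (cong (_+ - 1# * E (pow (ι (suc k)))) (e k))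
                (trans (+-comm _ _) (cancel (E (pow (ι (suc k)))))) }) h)) (+-identityˡ _))))
      where
      diff : Polynomial (λ h → D h + - 1# * E h)
      diff = +-polynomial p (*-polynomial (- 1#) q)
      cancel : ∀ x → - 1# * x + x ≡ 0#
      cancel x = trans (cong (- 1# * x +_) (sym (*-identityˡ x)))
        (trans (sym (distribʳ x (- 1#) 1#)) (trans (cong (_* x) (-‿inverseˡ 1#)) (zeroˡ x)))

    -- P π h = Σ cᵢ h(i), where Σ cᵢ xⁱ is the binomial coefficient of π in φ(x).
    convolution : (P : Permutation′ (suc m) → (ℕ → K) → K) → (∀ π → Polynomial (P π)) →
                  (∀ π k → P π (pow (ι k)) ≡ Φ k π) →
                  ∀ ρ g h → ∑ (permutations (suc m)) (λ σ → P σ g * P (ρ ∘ₚ flip σ) h) ≡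
                            ι (suc m) * P ρ (λ i → g i * h i)
    convolution {m} P poly value ρ g h = polynomial-ext
      (∑-polynomial Sₙ λ σ → *-polynomial (P σ g) (poly (ρ ∘ₚ flip σ)))
      (*-polynomial (ι (suc m)) (weighted-polynomial g (poly ρ)))
      at-power h
      where
      Sₙ = permutations (suc m)
      -- Both sides of the claim are linear in g and in h. Here both are powers, where the claim is
      -- `Φ-convolution`.
      at-powers : ∀ l k → ∑ Sₙ (λ σ → P (ρ ∘ₚ flip σ) (pow (ι (suc l))) * P σ (pow (ι (suc k)))) ≡
                          ι (suc m) * P ρ (λ i → pow (ι (suc l)) i * pow (ι (suc k)) i)
      at-powers l k = trans
        (∑-cong Sₙ λ σ → trans (*-comm _ _) (cong₂ _*_ (value σ (suc k)) (value (ρ ∘ₚ flip σ) (suc l))))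
        (trans (Φ-convolution k l ρ) (cong (ι (suc m) *_) (trans (sym (value ρ (suc l ℕ.* suc k)))
          (local (poly ρ) λ i _ → trans (cong (λ x → pow x i) (ι-* (suc l) (suc k))) (pow-* _ _ i)))))
      -- For h fixed as a power, both sides are polynomial functionals of g, so g becomes arbitrary.
      -- The outer use of `polynomial-ext` then frees h with this g fixed.
      at-power : ∀ l → ∑ Sₙ (λ σ → P σ g * P (ρ ∘ₚ flip σ) (pow (ι (suc l)))) ≡
                       ι (suc m) * P ρ (λ i → g i * pow (ι (suc l)) i)
      at-power l = trans (∑-cong Sₙ λ σ → *-comm _ _) (trans
        (polynomial-ext (∑-polynomial Sₙ λ σ → *-polynomial (P (ρ ∘ₚ flip σ) (pow (ι (suc l)))) (poly σ))
          (*-polynomial (ι (suc m)) (weighted-polynomial (pow (ι (suc l))) (poly ρ))) (at-powers l) g)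
        (cong (ι (suc m) *_) (local (poly ρ) λ i _ → *-comm _ _)))

    -- The identity in the group algebra

    module _ {m : ℕ} where
      private
        Sₙ = permutations (suc m)
        𝔾 = Group.monoid (𝔖 (suc m))
        ℕ² = +-0-rawMonoid ×ᴹ +-0-rawMonoid
      module KS = MonoidAlgebra rawRing (Group.rawMonoid (𝔖 (suc m))) _≟ₚ_
      open Algebra₁ (Group.rawMonoid (𝔖 (suc m))) _≟ₚ_
      module A₁ = Algebra₂ 𝔾 +-0-rawMonoid _≟ₚ_ _≟ℕ_
      module A₂ = Algebra₂ 𝔾 ℕ² _≟ₚ_ (×-decidable _≟ℕ_ _≟ℕ_)
      module KS[x] = Poly₁ KS.rawRing
      module KS[x,y] = Poly₂ KS.rawRing

      𝕏 𝕐 : KS[x,y].Elem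
      𝕏 = KS[x,y].term (KS.const 1#) (1 , 0)
      𝕐 = KS[x,y].term (KS.const 1#) (0 , 1)

      ⟪⟪⟫⟫-unit-term : ∀ ij h → ⟪⟪ KS[x,y].term (KS.const 1#) ij ⟫⟫ h ≡ h ij Perm.id
      ⟪⟪⟫⟫-unit-term ij h = trans (+-identityʳ _) (trans (+-identityʳ _) (*-identityˡ _))

      ⟪⟪⟫⟫-substitute-𝕏 : ∀ f h → A₂.Respectful h → ⟪⟪ A₂.substitute f 𝕏 ⟫⟫ h ≡ ⟪⟪ f ⟫⟫ (λ k → h (k , 0))
      ⟪⟪⟫⟫-substitute-𝕏 f = A₂.⟪⟪⟫⟫-substitute f 𝕏 (λ k → k , 0) refl (λ _ → refl) (λ _ → refl)
        (λ h _ → ⟪⟪⟫⟫-unit-term (1 , 0) h)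

      ⟪⟪⟫⟫-substitute-𝕐 : ∀ f h → A₂.Respectful h → ⟪⟪ A₂.substitute f 𝕐 ⟫⟫ h ≡ ⟪⟪ f ⟫⟫ (λ k → h (0 , k))
      ⟪⟪⟫⟫-substitute-𝕐 f = A₂.⟪⟪⟫⟫-substitute f 𝕐 (λ k → 0 , k) refl (λ _ → refl) (λ _ → refl)
        (λ h _ → ⟪⟪⟫⟫-unit-term (0 , 1) h)

      ⟪⟪⟫⟫-substitute-XY : ∀ f h → A₂.Respectful h →
                           ⟪⟪ A₂.substitute f (KS[x,y].mul 𝕏 𝕐) ⟫⟫ h ≡ ⟪⟪ f ⟫⟫ (λ k → h (k , k))
      ⟪⟪⟫⟫-substitute-XY f = A₂.⟪⟪⟫⟫-substitute f (KS[x,y].mul 𝕏 𝕐) (λ k → k , k) refl (λ _ → refl) (λ _ → refl)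
        (λ h resp → trans (A₂.⟪⟪⟫⟫-mul 𝕏 𝕐 h) (trans (⟪⟪⟫⟫-unit-term (1 , 0)
            (λ ij g → ⟪⟪ 𝕐 ⟫⟫ λ ij′ g′ → h (add ij ij′) (g′ ∘ₚ g)))
          (trans (⟪⟪⟫⟫-unit-term (0 , 1) (λ ij′ g′ → h (add (1 , 0) ij′) (g′ ∘ₚ Perm.id)))
              (resp (1 , 1) λ _ → refl))))
        where add = RawMonoid._∙_ ℕ²

      module _ (p : Permutation′ (suc m) → List (K × ℕ)) (value : ∀ π k → ⟪ p π ⟫ (pow (ι k)) ≡ Φ k π)
               (r : K) (r-inverse : r * ι (suc m) ≡ 1#) where

        -- For K = ℚ, r = 1/(m + 1) and p the binomial coefficients this is `φ (suc m)` by
        -- definition. Apart from r, the argument uses only the values of p at natural numbers.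
        ϕ : KS[x].Elem
        ϕ = KS[x].mul (KS[x].const (KS.const r))
              (foldr _++_ [] (map (λ π → map (λ (c , k) → KS.term c π , k) (p π)) Sₙ))

        ⟪⟪ϕ⟫⟫ : ∀ h → A₁.Respectful h → ⟪⟪ ϕ ⟫⟫ h ≡ r * ∑ Sₙ (λ π → ⟪ p π ⟫ λ k → h k π)
        ⟪⟪ϕ⟫⟫ h resp = begin
          ⟪⟪ ϕ ⟫⟫ h
            ≡⟨ A₁.⟪⟪⟫⟫-mul (KS[x].const (KS.const r)) (terms Sₙ) h ⟩
          ⟪⟪ KS[x].const (KS.const r) ⟫⟫ (λ i g → ⟪⟪ terms Sₙ ⟫⟫ λ j g′ → h (i ℕ.+ j) (g′ ∘ₚ g))
            ≡⟨ trans (A₁.⟪⟪⟫⟫-const (KS.const r) at-r) (⟪⟫-const r (at-r 0)) ⟩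
          r * ⟪⟪ terms Sₙ ⟫⟫ (λ j g′ → h j (g′ ∘ₚ Perm.id))
            ≡⟨ cong (r *_) (trans (⟪⟪⟫⟫-cong (terms Sₙ) λ j g → resp j λ _ → refl) (⟪⟪terms⟫⟫ Sₙ)) ⟩
          r * ∑ Sₙ (λ π → ⟪ p π ⟫ λ k → h k π) ∎
          where
          open ≡-Reasoning
          terms : List (Permutation′ (suc m)) → KS[x].Elem
          terms πs = foldr _++_ [] (map (λ π → map (λ (c , k) → KS.term c π , k) (p π)) πs)
          at-r : ℕ → Permutation′ (suc m) → K
          at-r i g = ⟪⟪ terms Sₙ ⟫⟫ λ j g′ → h (i ℕ.+ j) (g′ ∘ₚ g)
          ⟪⟪terms⟫⟫ : ∀ πs → ⟪⟪ terms πs ⟫⟫ h ≡ ∑ πs (λ π → ⟪ p π ⟫ λ k → h k π)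
          ⟪⟪terms⟫⟫ []       = refl
          ⟪⟪terms⟫⟫ (π ∷ πs) = trans (∑-++ (map _ (p π)) (terms πs) _) (cong₂ _+_
            (trans (∑-map _ (p π) _) (∑-cong (p π) λ _ → +-identityʳ _)) (⟪⟪terms⟫⟫ πs))

        polynomial : ∀ π → Polynomial ⟪ p π ⟫
        polynomial π = ∑-polynomial (p π) λ (c , i) → *-polynomial c (monomial i)

        private
          δ : ℕ → ℕ → K
          δ a i = ⟦ i ≟ℕ a ⟧

          -- Testing against this function reads off the coefficient of xᵃyᵇ at ρ.
          δ₂ : ∀ a b ρ → ℕ × ℕ → Permutation′ (suc m) → K
          δ₂ a b ρ ij π = ⟦ ×-decidable _≟ℕ_ _≟ℕ_ ij (a , b) ⟧ * ⟦ π ≟ₚ ρ ⟧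

          δ₂-respectful : ∀ a b ρ → A₂.Respectful (δ₂ a b ρ)
          δ₂-respectful a b ρ ij {σ} {τ} e = cong (⟦ ×-decidable _≟ℕ_ _≟ℕ_ ij (a , b) ⟧ *_)
            (⟦⟧-⇔ (σ ≟ₚ ρ) (τ ≟ₚ ρ) (λ f i → trans (sym (e i)) (f i)) (λ f i → trans (e i) (f i)))

          δ₂-split : ∀ a b ρ i j π → δ₂ a b ρ (i , j) π ≡ ⟦ π ≟ₚ ρ ⟧ * (δ a i * δ b j)
          δ₂-split a b ρ i j π = trans (*-comm _ _) (cong (⟦ π ≟ₚ ρ ⟧ *_) (⟦⟧-× (i ≟ℕ a) (j ≟ℕ b)))

          ∑-≟ₚ : ∀ {ρ} (F : Permutation′ (suc m) → K) → (∀ {σ τ} → σ ≈ₚ τ → F σ ≡ F τ) →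
                 ∑ Sₙ (λ π → ⟦ π ≟ₚ ρ ⟧ * F π) ≡ F ρ
          ∑-≟ₚ {ρ} F F-cong = Enumeration.∑-δ (perms (suc m)) ρ F F-cong

        -- Nothing makes the lists p σ and p τ equal for σ ≈ τ, but their values at integers agree,
        -- and these determine the functionals.
        P-cong : ∀ h {σ τ} → σ ≈ₚ τ → ⟪ p σ ⟫ h ≡ ⟪ p τ ⟫ h
        P-cong h {σ} {τ} e = polynomial-ext (polynomial σ) (polynomial τ)
          (λ k → trans (value σ (suc k)) (trans (Φ-cong (suc k) {σ} {τ} e) (sym (value τ (suc k))))) h

        ϕ-square : ∀ a b ρ → ⟪⟪ A₂.substitute ϕ (KS[x,y].mul 𝕏 𝕐) ⟫⟫ (δ₂ a b ρ) ≡
                             r * ⟪ p ρ ⟫ (λ k → δ a k * δ b k)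
        ϕ-square a b ρ = begin
          ⟪⟪ A₂.substitute ϕ (KS[x,y].mul 𝕏 𝕐) ⟫⟫ (δ₂ a b ρ)
            ≡⟨ ⟪⟪⟫⟫-substitute-XY ϕ (δ₂ a b ρ) (δ₂-respectful a b ρ) ⟩
          ⟪⟪ ϕ ⟫⟫ (λ k → δ₂ a b ρ (k , k))
            ≡⟨ ⟪⟪ϕ⟫⟫ _ (λ k {σ} {τ} → δ₂-respectful a b ρ (k , k) {σ} {τ}) ⟩
          r * ∑ Sₙ (λ π → ⟪ p π ⟫ λ k → δ₂ a b ρ (k , k) π)
            ≡⟨ cong (r *_) (trans (∑-cong Sₙ λ π → trans (⟪⟫-cong (p π) λ k → δ₂-split a b ρ k k π)
                (⟪⟫-*ˡ (p π) ⟦ π ≟ₚ ρ ⟧ _))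
                 (∑-≟ₚ (λ π → ⟪ p π ⟫ (λ k → δ a k * δ b k)) (λ {σ} {τ} → P-cong _ {σ} {τ}))) ⟩
          r * ⟪ p ρ ⟫ (λ k → δ a k * δ b k) ∎
          where open ≡-Reasoning

        ϕ-product : ∀ a b ρ → ⟪⟪ KS[x,y].mul (A₂.substitute ϕ 𝕏) (A₂.substitute ϕ 𝕐) ⟫⟫ (δ₂ a b ρ) ≡
                              r * ⟪ p ρ ⟫ (λ k → δ a k * δ b k)
        ϕ-product a b ρ = begin
          ⟪⟪ KS[x,y].mul (A₂.substitute ϕ 𝕏) (A₂.substitute ϕ 𝕐) ⟫⟫ (δ₂ a b ρ)
            ≡⟨ A₂.⟪⟪⟫⟫-mul (A₂.substitute ϕ 𝕏) (A₂.substitute ϕ 𝕐) (δ₂ a b ρ) ⟩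
          ⟪⟪ A₂.substitute ϕ 𝕏 ⟫⟫ (λ ij σ → ⟪⟪ A₂.substitute ϕ 𝕐 ⟫⟫ λ ij′ τ → δ₂ a b ρ (add ij ij′) (τ ∘ₚ σ))
            ≡⟨ ⟪⟪⟫⟫-cong (A₂.substitute ϕ 𝕏) (λ ij σ → ⟪⟪⟫⟫-substitute-𝕐 ϕ
                (λ ij′ τ → δ₂ a b ρ (add ij ij′) (τ ∘ₚ σ))
                 λ ij′ {τ} {τ′} e → δ₂-respectful a b ρ (add ij ij′) {τ ∘ₚ σ} {τ′ ∘ₚ σ} λ i → cong
                     (σ ⟨$⟩ʳ_) (e i)) ⟩
          ⟪⟪ A₂.substitute ϕ 𝕏 ⟫⟫ (λ ij σ → ⟪⟪ ϕ ⟫⟫ λ l τ → δ₂ a b ρ (add ij (0 , l)) (τ ∘ₚ σ))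
            ≡⟨ ⟪⟪⟫⟫-substitute-𝕏 ϕ (λ ij σ → ⟪⟪ ϕ ⟫⟫ λ l τ → δ₂ a b ρ (add ij (0 , l)) (τ ∘ₚ σ))
                (λ ij {σ} {σ′} → respectful ij {σ} {σ′}) ⟩
          ⟪⟪ ϕ ⟫⟫ (λ k σ → ⟪⟪ ϕ ⟫⟫ λ l τ → δ₂ a b ρ (add (k , 0) (0 , l)) (τ ∘ₚ σ))
            ≡⟨ ⟪⟪ϕ⟫⟫ (λ k σ → ⟪⟪ ϕ ⟫⟫ λ l τ → δ₂ a b ρ (add (k , 0) (0 , l)) (τ ∘ₚ σ))
                (λ k {σ} {σ′} → respectful (k , 0) {σ} {σ′}) ⟩
          r * ∑ Sₙ (λ σ → ⟪ p σ ⟫ λ k → ⟪⟪ ϕ ⟫⟫ λ l τ → δ₂ a b ρ (add (k , 0) (0 , l)) (τ ∘ₚ σ))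
            ≡⟨ cong (r *_) (∑-cong Sₙ λ σ → trans (⟪⟫-cong (p σ) (inner σ))
                (trans (⟪⟫-*ˡ (p σ) (r * ⟪ p (ρ ∘ₚ flip σ) ⟫ (δ b)) (δ a))
                 (trans (*-assoc _ _ _) (cong (r *_) (*-comm _ _))))) ⟩
          r * ∑ Sₙ (λ σ → r * (⟪ p σ ⟫ (δ a) * ⟪ p (ρ ∘ₚ flip σ) ⟫ (δ b)))
            ≡⟨ cong (r *_) (trans (∑-*ˡ Sₙ r _) (cong (r *_)
                (convolution (λ π → ⟪ p π ⟫) polynomial value ρ (δ a) (δ b)))) ⟩
          r * (r * (ι (suc m) * ⟪ p ρ ⟫ (λ k → δ a k * δ b k)))
            -- Each factor φ carries one r = 1/(m + 1); the factor m + 1 produced by `convolution`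
            -- absorbs one of the two.
            ≡⟨ cong (r *_) (trans (sym (*-assoc _ _ _))
                (trans (cong (_* ⟪ p ρ ⟫ (λ k → δ a k * δ b k)) r-inverse) (*-identityˡ _))) ⟩
          r * ⟪ p ρ ⟫ (λ k → δ a k * δ b k) ∎
          where
          open ≡-Reasoning
          add = RawMonoid._∙_ ℕ²
          respectful : A₂.Respectful (λ ij σ → ⟪⟪ ϕ ⟫⟫ λ l τ → δ₂ a b ρ (add ij (0 , l)) (τ ∘ₚ σ))
          respectful ij {σ} {σ′} e = ⟪⟪⟫⟫-cong ϕ λ l τ → δ₂-respectful a b ρ
              (add ij (0 , l)) {τ ∘ₚ σ} {τ ∘ₚ σ′} λ i → e (τ ⟨$⟩ʳ i)
          quotient-≟ₚ : ∀ σ τ → ⟦ (τ ∘ₚ σ) ≟ₚ ρ ⟧ ≡ ⟦ τ ≟ₚ (ρ ∘ₚ flip σ) ⟧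
          quotient-≟ₚ σ τ = ⟦⟧-⇔ ((τ ∘ₚ σ) ≟ₚ ρ) (τ ≟ₚ (ρ ∘ₚ flip σ))
            (λ e i → trans (sym (inverseˡ σ)) (cong (σ ⟨$⟩ˡ_) (e i)))
            (λ e i → trans (cong (σ ⟨$⟩ʳ_) (e i)) (inverseʳ σ))
          inner : ∀ σ k → ⟪⟪ ϕ ⟫⟫ (λ l τ → δ₂ a b ρ (add (k , 0) (0 , l)) (τ ∘ₚ σ)) ≡
                          r * ⟪ p (ρ ∘ₚ flip σ) ⟫ (δ b) * δ a k
          inner σ k = begin
            ⟪⟪ ϕ ⟫⟫ (λ l τ → δ₂ a b ρ (add (k , 0) (0 , l)) (τ ∘ₚ σ))
              ≡⟨ ⟪⟪ϕ⟫⟫ (λ l τ → δ₂ a b ρ (add (k , 0) (0 , l)) (τ ∘ₚ σ))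
                   (λ l {τ} {τ′} e → δ₂-respectful a b ρ (add (k , 0) (0 , l)) {τ ∘ₚ σ} {τ′ ∘ₚ σ}
                       λ i → cong (σ ⟨$⟩ʳ_) (e i)) ⟩
            r * ∑ Sₙ (λ τ → ⟪ p τ ⟫ λ l → δ₂ a b ρ (add (k , 0) (0 , l)) (τ ∘ₚ σ))
              ≡⟨ cong (r *_) (∑-cong Sₙ λ τ → trans
                   (⟪⟫-cong (p τ) λ l → trans (δ₂-split a b ρ (k ℕ.+ 0) l (τ ∘ₚ σ))
                     (trans (cong₂ (λ x y → x * (δ a y * δ b l)) (quotient-≟ₚ σ τ) (ℕₚ.+-identityʳ k))
                       (sym (*-assoc _ _ _))))
                   (trans (⟪⟫-*ˡ (p τ) (⟦ τ ≟ₚ (ρ ∘ₚ flip σ) ⟧ * δ a k) (δ b)) (*-assoc _ _ _))) ⟩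
            r * ∑ Sₙ (λ τ → ⟦ τ ≟ₚ (ρ ∘ₚ flip σ) ⟧ * (δ a k * ⟪ p τ ⟫ (δ b)))
              ≡⟨ cong (r *_) (∑-≟ₚ {ρ ∘ₚ flip σ} (λ τ → δ a k * ⟪ p τ ⟫ (δ b))
                  (λ {τ} {τ′} e → cong (δ a k *_) (P-cong (δ b) {τ} {τ′} e))) ⟩
            r * (δ a k * ⟪ p (ρ ∘ₚ flip σ) ⟫ (δ b))
              ≡⟨ trans (cong (r *_) (*-comm _ _)) (sym (*-assoc _ _ _)) ⟩
            r * ⟪ p (ρ ∘ₚ flip σ) ⟫ (δ b) * δ a k ∎

        ϕ-multiplicative : KS[x,y].mul (A₂.substitute ϕ 𝕏) (A₂.substitute ϕ 𝕐) KS[x,y].≋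
                           A₂.substitute ϕ (KS[x,y].mul 𝕏 𝕐)
        ϕ-multiplicative (a , b) ρ = begin
          KS.coeff (KS[x,y].coeff (KS[x,y].mul (A₂.substitute ϕ 𝕏) (A₂.substitute ϕ 𝕐)) (a , b)) ρ
            ≡⟨ A₂.coeff-coeff (KS[x,y].mul (A₂.substitute ϕ 𝕏) (A₂.substitute ϕ 𝕐)) (a , b) ρ ⟩
          ⟪⟪ KS[x,y].mul (A₂.substitute ϕ 𝕏) (A₂.substitute ϕ 𝕐) ⟫⟫ (δ₂ a b ρ)
            ≡⟨ trans (ϕ-product a b ρ) (sym (ϕ-square a b ρ)) ⟩
          ⟪⟪ A₂.substitute ϕ (KS[x,y].mul 𝕏 𝕐) ⟫⟫ (δ₂ a b ρ)
            ≡⟨ A₂.coeff-coeff (A₂.substitute ϕ (KS[x,y].mul 𝕏 𝕐)) (a , b) ρ ⟨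
          KS.coeff (KS[x,y].coeff (A₂.substitute ϕ (KS[x,y].mul 𝕏 𝕐)) (a , b)) ρ ∎
          where open ≡-Reasoning

-- The rational numbers

/-+ : ∀ m n → (ℤ.+ m / 1) ℚ.+ (ℤ.+ n / 1) ≡ ℤ.+ (m ℕ.+ n) / 1
/-+ m n = ℚₚ.toℚᵘ-injective (begin
  toℚᵘ ((ℤ.+ m / 1) ℚ.+ (ℤ.+ n / 1))           ≈⟨ ℚₚ.toℚᵘ-homo-+ (ℤ.+ m / 1) (ℤ.+ n / 1) ⟩
  toℚᵘ (ℤ.+ m / 1) ℚᵘ.+ toℚᵘ (ℤ.+ n / 1)       ≈⟨ ℚᵘₚ.+-cong (ℚₚ.toℚᵘ-fromℚᵘ (mkℚᵘ (ℤ.+ m) 0))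
      (ℚₚ.toℚᵘ-fromℚᵘ (mkℚᵘ (ℤ.+ n) 0)) ⟩
  mkℚᵘ (ℤ.+ m) 0 ℚᵘ.+ mkℚᵘ (ℤ.+ n) 0           ≈⟨ *≡* (cong (ℤ._* ℤ.+ 1)
      (cong₂ ℤ._+_ (ℤₚ.*-identityʳ (ℤ.+ m)) (ℤₚ.*-identityʳ (ℤ.+ n)))) ⟩
  mkℚᵘ (ℤ.+ (m ℕ.+ n)) 0                       ≈⟨ ℚₚ.toℚᵘ-fromℚᵘ (mkℚᵘ (ℤ.+ (m ℕ.+ n)) 0) ⟨
  toℚᵘ (ℤ.+ (m ℕ.+ n) / 1)                     ∎)
  where open ℚᵘₚ.≃-Reasoning

/-inverse : ∀ n .{{_ : NonZero n}} → (ℤ.+ n / 1) ℚ.* (ℤ.+ 1 / n) ≡ ℚ.1ℚ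
/-inverse (suc d) = ℚₚ.toℚᵘ-injective (begin
  toℚᵘ ((ℤ.+ suc d / 1) ℚ.* (ℤ.+ 1 / suc d))     ≈⟨ ℚₚ.toℚᵘ-homo-* (ℤ.+ suc d / 1) (ℤ.+ 1 / suc d) ⟩
  toℚᵘ (ℤ.+ suc d / 1) ℚᵘ.* toℚᵘ (ℤ.+ 1 / suc d) ≈⟨ ℚᵘₚ.*-cong (ℚₚ.toℚᵘ-fromℚᵘ (mkℚᵘ (ℤ.+ suc d) 0))
      (ℚₚ.toℚᵘ-fromℚᵘ (mkℚᵘ (ℤ.+ 1) d)) ⟩
  mkℚᵘ (ℤ.+ suc d) 0 ℚᵘ.* mkℚᵘ (ℤ.+ 1) d         ≈⟨ *≡*
      (cong ℤ.+_ (cong suc (trans (trans (ℕₚ.*-identityʳ _) (ℕₚ.*-identityʳ d))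
          (sym (trans (ℕₚ.+-identityʳ _) (ℕₚ.+-identityʳ d)))))) ⟩
  toℚᵘ ℚ.1ℚ                                       ∎)
  where open ℚᵘₚ.≃-Reasoning

module _ where

  open OverCommutativeRing ℚₚ.+-*-isCommutativeRing

  ι≡/1 : ∀ k → ι k ≡ ℤ.+ k / 1
  ι≡/1 zero    = refl
  ι≡/1 (suc k) = trans (cong (ℚ.1ℚ ℚ.+_) (ι≡/1 k)) (/-+ 1 k)

  invFact : ℕ → ℚ
  invFact n = (ℤ.+ 1 / (n !)) {{n !≢0}}

  invFact-inverse : ∀ n → ι (n !) ℚ.* invFact n ≡ ℚ.1ℚ
  invFact-inverse n = trans (cong (ℚ._* invFact n) (ι≡/1 (n !))) (/-inverse (n !) {{n !≢0}})

  open Binomial invFact invFact-inverse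
  open Algebra₁ +-0-rawMonoid _≟ℕ_

  module _ (z : ℚ) where
    open RawRing ℚ[x] using () renaming (_*_ to _*ᵖ_; _+_ to _+ᵖ_; -_ to -ᵖ_)

    eval : RawRing.Carrier ℚ[x] → ℚ
    eval p = ⟪ p ⟫ (pow z)

    eval-+ : ∀ p q → eval (p +ᵖ q) ≡ eval p + eval q
    eval-+ p q = ∑-++ p q _

    eval-* : ∀ p q → eval (p *ᵖ q) ≡ eval p * eval q
    eval-* p q = begin
      eval (p *ᵖ q)                           ≡⟨ ⟪⟫-mul p q (pow z) ⟩
      ⟪ p ⟫ (λ i → ⟪ q ⟫ λ j → pow z (i ℕ.+ j)) ≡⟨ ⟪⟫-cong p (λ i → trans (⟪⟫-cong q λ j → pow-+ z i j)
                                                  (trans (⟪⟫-*ˡ q (pow z i) (pow z))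
                                                      (*-comm (pow z i) (eval q)))) ⟩
      ⟪ p ⟫ (λ i → eval q * pow z i)          ≡⟨ ⟪⟫-*ˡ p (eval q) (pow z) ⟩
      eval q * eval p                         ≡⟨ *-comm (eval q) (eval p) ⟩
      eval p * eval q                         ∎
      where open ≡-Reasoning

    eval-const : ∀ c → eval (Poly₁.const ℚ.+-*-rawRing c) ≡ c
    eval-const c = trans (⟪⟫-const c (pow z)) (*-identityʳ c)

    eval-fromℕ : ∀ k → eval (fromℕ k) ≡ ι k
    eval-fromℕ k = trans (eval-const (ℤ.+ k / 1)) (sym (ι≡/1 k))

    eval-neg-fromℕ : ∀ k → eval (-ᵖ fromℕ k) ≡ - ι k
    eval-neg-fromℕ k = trans (eval-const (- (ℤ.+ k / 1))) (cong -_ (sym (ι≡/1 k)))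

    eval-fallingFactorial : ∀ p j → eval (fallingFactorial p j) ≡ falling (eval p) j
    eval-fallingFactorial p zero    = eval-const ℚ.1ℚ
    eval-fallingFactorial p (suc j) = trans (eval-* (fallingFactorial p j) (p +ᵖ -ᵖ fromℕ j))
      (cong₂ _*_ (eval-fallingFactorial p j) (trans (eval-+ p (-ᵖ fromℕ j))
          (cong (eval p +_) (eval-neg-fromℕ j))))

    eval-binomial : ∀ p j → eval (binomial p j) ≡ binom (eval p) j
    eval-binomial p j = trans (eval-* (Poly₁.const ℚ.+-*-rawRing (invFact j)) (fallingFactorial p j))
      (cong₂ _*_ (eval-const (invFact j)) (eval-fallingFactorial p j))

  module _ {m : ℕ} (π : Permutation′ (suc m)) where
    open RawRing ℚ[x] using () renaming (_+_ to _+ᵖ_; -_ to -ᵖ_)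

    private
      x = Poly₁.term ℚ.+-*-rawRing (ℤ.+ 1 / 1) 1

    coefficient : RawRing.Carrier ℚ[x]
    coefficient = binomial (x +ᵖ fromℕ m +ᵖ -ᵖ fromℕ (cdes π)) m

    coefficient-value : ∀ k → eval (ι k) coefficient ≡ Φ k π
    coefficient-value k = trans (eval-binomial (ι k) (x +ᵖ fromℕ m +ᵖ -ᵖ fromℕ (cdes π)) m)
        (cong (λ z → binom z m) (begin
      eval (ι k) (x +ᵖ fromℕ m +ᵖ -ᵖ fromℕ (cdes π))
        ≡⟨ trans (eval-+ (ι k) (x +ᵖ fromℕ m) (-ᵖ fromℕ (cdes π)))
            (cong (_+ eval (ι k) (-ᵖ fromℕ (cdes π))) (eval-+ (ι k) x (fromℕ m))) ⟩
      eval (ι k) x + eval (ι k) (fromℕ m) + eval (ι k) (-ᵖ fromℕ (cdes π))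
        ≡⟨ cong₂ _+_ (cong₂ _+_ eval-x (eval-fromℕ (ι k) m)) (eval-neg-fromℕ (ι k) (cdes π)) ⟩
      ι k + ι m - ι (cdes π) ∎))
      where
      open ≡-Reasoning
      eval-x : eval (ι k) x ≡ ι k
      eval-x = trans (+-identityʳ (ℚ.1ℚ * (ι k * ℚ.1ℚ))) (trans (*-identityˡ (ι k * ℚ.1ℚ)) (*-identityʳ (ι k)))

  r-inverse : ∀ m → (ℤ.+ 1 / suc m) * ι (suc m) ≡ ℚ.1ℚ
  r-inverse m = trans (*-comm (ℤ.+ 1 / suc m) (ι (suc m)))
      (trans (cong (_* (ℤ.+ 1 / suc m)) (ι≡/1 (suc m))) (/-inverse (suc m)))

theorem1p2 : (n : ℕ) .{{_ : NonZero n}} →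
    let open RawRing (ℚ𝔖[x,y] n) in
    φ n ⟨ X ⟩ * φ n ⟨ Y ⟩ ≈ φ n ⟨ X * Y ⟩
theorem1p2 (suc m) = OverCommutativeRing.Binomial.ϕ-multiplicative ℚₚ.+-*-isCommutativeRing invFact invFact-inverse
  coefficient coefficient-value (ℤ.+ 1 / suc m) (r-inverse m)
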